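{- Let $G$ be a connected, true-twin-free, claw-free graph. Then $G$ is CIS if and only if one of the following holds: (1) $G\cong \overline{pK_2+qK_1}$ for some integer $p\ge 0$ and $q\in\{0,1\}$; (2) $G\cong L(K_{n,n})$ for some $n\ge 1$; (3) $G\cong L(G'\circ K_1)$ for some triangle-free graph $G'$.
   Context: All graphs are finite, simple and non-null. A graph is CIS if every inclusion-maximal clique intersects every inclusion-maximal stable set. The claw is $K_{1,3}$. Vertices $x,y$ are true twins if $N[x]=N[y]$; a graph is true-twin-free if it has no two distinct true twins. $\overline{F}$ is the complement of $F$, $F+F'$ the disjoint union and $kF$ the disjoint union of $k$ copies of $F$. $L(H)$ denotes the line graph of $H$. The corona $G'\circ K_1$ is obtained from $G'$ by adding, for each vertex $v$, a new vertex $v'$ adjacent only to $v$. -}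

module Defs where

open import Data.Nat using (ℕ; zero; suc; _+_)
open import Data.Bool using (Bool; true; false; not; if_then_else_; _∧_)
open import Data.Fin using (Fin; _<_; splitAt)
open import Data.Fin.Properties using (_≟_)
open import Data.Sum using (_⊎_; inj₁; inj₂)
open import Data.Product using (Σ; ∃; _×_; _,_; proj₁; proj₂)
open import Relation.Nullary using (¬_; yes; no)
open import Relation.Nullary.Decidable using (⌊_⌋)
open import Relation.Binary.PropositionalEquality using (_≡_; _≢_; refl; sym)
open import Function.Bundles using (_↔_; Inverse)

record Graph : Set where
  field
    n      : ℕ
    adj    : Fin n → Fin n → Bool
    adj-sym    : ∀ x y → adj x y ≡ adj y x
    adj-irrefl : ∀ x → adj x x ≡ false
open Graph public

eqb : ∀ {n} → Fin n → Fin n → Bool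
eqb x y = ⌊ x ≟ y ⌋

eqb-refl : ∀ {n} (x : Fin n) → eqb x x ≡ true
eqb-refl x with x ≟ x
... | yes _ = refl
... | no ¬p = Data.Empty.⊥-elim (¬p refl)
  where import Data.Empty

eqb-sym : ∀ {n} (x y : Fin n) → eqb x y ≡ eqb y x
eqb-sym x y with x ≟ y | y ≟ x
... | yes _ | yes _ = refl
... | no _  | no _  = refl
... | yes p | no q  = Data.Empty.⊥-elim (q (sym p))
  where import Data.Empty
... | no p  | yes q = Data.Empty.⊥-elim (p (sym q))
  where import Data.Empty

record _≅_ (G H : Graph) : Set where
  field
    iso      : Fin (n G) ↔ Fin (n H)
    preserve : ∀ x y → adj G x y ≡ adj H (Inverse.to iso x) (Inverse.to iso y)

data Reach (G : Graph) : Fin (n G) → Fin (n G) → Set where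
  here : ∀ {x} → Reach G x x
  step : ∀ {x y z} → adj G x y ≡ true → Reach G y z → Reach G x z

Connected : Graph → Set
Connected G = ∀ x y → Reach G x y

InClosedNbhd : (G : Graph) → Fin (n G) → Fin (n G) → Set
InClosedNbhd G x z = (z ≡ x) ⊎ (adj G x z ≡ true)

TrueTwins : (G : Graph) → Fin (n G) → Fin (n G) → Set
TrueTwins G x y = ∀ z → (InClosedNbhd G x z → InClosedNbhd G y z)
                      × (InClosedNbhd G y z → InClosedNbhd G x z)

TrueTwinFree : Graph → Set
TrueTwinFree G = ∀ x y → x ≢ y → ¬ TrueTwins G x y

ClawFree : Graph → Set
ClawFree G = ∀ a b c d → b ≢ c → b ≢ d → c ≢ d →
  adj G a b ≡ true → adj G a c ≡ true → adj G a d ≡ true →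
  adj G b c ≡ false → adj G b d ≡ false → adj G c d ≡ false → Data.Empty.⊥
  where import Data.Empty

TriangleFree : Graph → Set
TriangleFree G = ∀ x y z → adj G x y ≡ true → adj G y z ≡ true →
  adj G x z ≡ true → Data.Empty.⊥
  where import Data.Empty

VSet : Graph → Set
VSet G = Fin (n G) → Bool

_⊆ᵥ_ : ∀ {G} → VSet G → VSet G → Set
S ⊆ᵥ T = ∀ x → S x ≡ true → T x ≡ true

IsClique : (G : Graph) → VSet G → Set
IsClique G S = ∀ x y → S x ≡ true → S y ≡ true → x ≢ y → adj G x y ≡ true

IsStable : (G : Graph) → VSet G → Set
IsStable G S = ∀ x y → S x ≡ true → S y ≡ true → adj G x y ≡ false

IsMaxClique : (G : Graph) → VSet G → Set
IsMaxClique G S = IsClique G S × (∀ T → IsClique G T → _⊆ᵥ_ {G} S T → _⊆ᵥ_ {G} T S)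

IsMaxStable : (G : Graph) → VSet G → Set
IsMaxStable G S = IsStable G S × (∀ T → IsStable G T → _⊆ᵥ_ {G} S T → _⊆ᵥ_ {G} T S)

CIS : Graph → Set
CIS G = ∀ C S → IsMaxClique G C → IsMaxStable G S →
  ∃ λ x → (C x ≡ true) × (S x ≡ true)

not-cong : ∀ {a b} → a ≡ b → not a ≡ not b
not-cong refl = refl

compl-adj : (G : Graph) → Fin (n G) → Fin (n G) → Bool
compl-adj G x y = if eqb x y then false else not (adj G x y)

compl-sym : (G : Graph) → ∀ x y → compl-adj G x y ≡ compl-adj G y x
compl-sym G x y rewrite eqb-sym x y | adj-sym G x y = refl

compl-irr : (G : Graph) → ∀ x → compl-adj G x x ≡ false
compl-irr G x rewrite eqb-refl x = refl

complement : Graph → Graph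
complement G = record { n = n G ; adj = compl-adj G
                      ; adj-sym = compl-sym G ; adj-irrefl = compl-irr G }

K-adj : ∀ {k} → Fin k → Fin k → Bool
K-adj x y = not (eqb x y)

K : ℕ → Graph
K k = record { n = k ; adj = K-adj
             ; adj-sym = λ x y → not-cong (eqb-sym x y)
             ; adj-irrefl = λ x → not-cong (eqb-refl x) }

K₂ K₁ : Graph
K₂ = K 2
K₁ = K 1

nullGraph : Graph
nullGraph = record { n = 0 ; adj = λ () ; adj-sym = λ () ; adj-irrefl = λ () }

sumAdj : ∀ {a b} → (Fin a → Fin a → Bool) → (Fin b → Fin b → Bool)
       → Fin a ⊎ Fin b → Fin a ⊎ Fin b → Bool
sumAdj f g (inj₁ x) (inj₁ y) = f x y
sumAdj f g (inj₂ x) (inj₂ y) = g x y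
sumAdj f g (inj₁ x) (inj₂ y) = false
sumAdj f g (inj₂ x) (inj₁ y) = false

sumAdj-sym : ∀ {a b} (f : Fin a → Fin a → Bool) (g : Fin b → Fin b → Bool)
  → (∀ x y → f x y ≡ f y x) → (∀ x y → g x y ≡ g y x)
  → ∀ u v → sumAdj f g u v ≡ sumAdj f g v u
sumAdj-sym f g fs gs (inj₁ x) (inj₁ y) = fs x y
sumAdj-sym f g fs gs (inj₂ x) (inj₂ y) = gs x y
sumAdj-sym f g fs gs (inj₁ x) (inj₂ y) = refl
sumAdj-sym f g fs gs (inj₂ x) (inj₁ y) = refl

sumAdj-irr : ∀ {a b} (f : Fin a → Fin a → Bool) (g : Fin b → Fin b → Bool)
  → (∀ x → f x x ≡ false) → (∀ x → g x x ≡ false)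
  → ∀ u → sumAdj f g u u ≡ false
sumAdj-irr f g fi gi (inj₁ x) = fi x
sumAdj-irr f g fi gi (inj₂ x) = gi x

_⊕_ : Graph → Graph → Graph
G ⊕ H = record
  { n = n G + n H
  ; adj = λ x y → sumAdj (adj G) (adj H) (splitAt (n G) x) (splitAt (n G) y)
  ; adj-sym = λ x y → sumAdj-sym (adj G) (adj H) (adj-sym G) (adj-sym H)
                        (splitAt (n G) x) (splitAt (n G) y)
  ; adj-irrefl = λ x → sumAdj-irr (adj G) (adj H) (adj-irrefl G) (adj-irrefl H)
                        (splitAt (n G) x) }

_·_ : ℕ → Graph → Graph
zero  · F = nullGraph
suc k · F = F ⊕ (k · F)

bipAdj : ∀ {a b} → Fin a ⊎ Fin b → Fin a ⊎ Fin b → Bool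
bipAdj (inj₁ _) (inj₂ _) = true
bipAdj (inj₂ _) (inj₁ _) = true
bipAdj (inj₁ _) (inj₁ _) = false
bipAdj (inj₂ _) (inj₂ _) = false

bipAdj-sym : ∀ {a b} (u v : Fin a ⊎ Fin b) → bipAdj u v ≡ bipAdj v u
bipAdj-sym (inj₁ _) (inj₁ _) = refl
bipAdj-sym (inj₁ _) (inj₂ _) = refl
bipAdj-sym (inj₂ _) (inj₁ _) = refl
bipAdj-sym (inj₂ _) (inj₂ _) = refl

bipAdj-irr : ∀ {a b} (u : Fin a ⊎ Fin b) → bipAdj u u ≡ false
bipAdj-irr (inj₁ _) = refl
bipAdj-irr (inj₂ _) = refl

Kbip : ℕ → Graph
Kbip k = record
  { n = k + k
  ; adj = λ x y → bipAdj (splitAt k x) (splitAt k y)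
  ; adj-sym = λ x y → bipAdj-sym (splitAt k x) (splitAt k y)
  ; adj-irrefl = λ x → bipAdj-irr (splitAt k x) }

-- corona G ∘ K₁ : vertices Fin (n + n); inj₁ v is v, inj₂ v is the pendant v'
corAdj : ∀ {a} → (Fin a → Fin a → Bool) → Fin a ⊎ Fin a → Fin a ⊎ Fin a → Bool
corAdj f (inj₁ x) (inj₁ y) = f x y
corAdj f (inj₁ x) (inj₂ y) = eqb x y
corAdj f (inj₂ x) (inj₁ y) = eqb x y
corAdj f (inj₂ x) (inj₂ y) = false

corAdj-sym : ∀ {a} (f : Fin a → Fin a → Bool) → (∀ x y → f x y ≡ f y x)
  → ∀ u v → corAdj f u v ≡ corAdj f v u
corAdj-sym f fs (inj₁ x) (inj₁ y) = fs x y
corAdj-sym f fs (inj₁ x) (inj₂ y) = eqb-sym x y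
corAdj-sym f fs (inj₂ x) (inj₁ y) = eqb-sym x y
corAdj-sym f fs (inj₂ x) (inj₂ y) = refl

corAdj-irr : ∀ {a} (f : Fin a → Fin a → Bool) → (∀ x → f x x ≡ false)
  → ∀ u → corAdj f u u ≡ false
corAdj-irr f fi (inj₁ x) = fi x
corAdj-irr f fi (inj₂ x) = refl

corona : Graph → Graph
corona G = record
  { n = n G + n G
  ; adj = λ x y → corAdj (adj G) (splitAt (n G) x) (splitAt (n G) y)
  ; adj-sym = λ x y → corAdj-sym (adj G) (adj-sym G) (splitAt (n G) x) (splitAt (n G) y)
  ; adj-irrefl = λ x → corAdj-irr (adj G) (adj-irrefl G) (splitAt (n G) x) }

-- Line graphs.  The vertex set of L(H) is the edge set of H, each edge
-- {i,j} represented once as the pair (i , j) with i < j.  Two edges are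
-- adjacent in L(H) iff they are distinct and share an endpoint.

Edge : Graph → Set
Edge H = Σ (Fin (n H) × Fin (n H))
           λ p → (proj₁ p < proj₂ p) × (adj H (proj₁ p) (proj₂ p) ≡ true)

endpoint : ∀ {H} → Edge H → Fin (n H) → Set
endpoint e v = (v ≡ proj₁ (proj₁ e)) ⊎ (v ≡ proj₂ (proj₁ e))

LineAdj : (H : Graph) → Edge H → Edge H → Set
LineAdj H e f = (e ≢ f) × ∃ λ v → endpoint {H} e v × endpoint {H} f v

record _≅L_ (G H : Graph) : Set where
  field
    iso      : Fin (n G) ↔ Edge H
    preserve : ∀ x y → (adj G x y ≡ true →
                          LineAdj H (Inverse.to iso x) (Inverse.to iso y))
                     × (LineAdj H (Inverse.to iso x) (Inverse.to iso y) →
                          adj G x y ≡ true)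

{-# OPTIONS --safe #-}

-- Write x ≈ y for y ∈ N[x] and x # y for distinct non-adjacent x, y.  By CIS, a clique K and a stable
-- set T always admit a vertex z with z ≈ k for all k ∈ K and z ≁ t for all t ∈ T.  With claw-freeness
-- this forces the complement of every neighbourhood to be a disjoint union of complete bipartite
-- graphs.  If G contains a diamond, then, its two central vertices not being twins, G contains a wheel
-- with four spokes; connectedness then leaves no stable triple, and the same argument applied to all
-- of G makes the complement a union of edges plus at most one isolated vertex.
--
-- In a diamond-free G, take a maximal stable set S containing all simplicial vertices, s, t ∈ S with a
-- common neighbour v, and t not simplicial.  Exchanging s, t for v in S produces another common
-- neighbour c # v.  If s is simplicial this is impossible, so one simplicial vertex spreads along the
-- connected graph until every vertex lies in the closed neighbourhood of a simplicial one: G is then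
-- L(G' ∘ K₁), the vertices of G' being the simplicial vertices.  Without simplicial vertices, c closes
-- every path s v t to a square, which makes G the rook graph on the two maximal cliques through any
-- vertex; comparison of the diagonal with a column shows that the board is square.
module Submission where

open import Defs
open import Axiom.UniquenessOfIdentityProofs using (module Decidable⇒UIP)
open import Data.Bool using (Bool; true; false; not; _∨_)
import Data.Bool.Properties as Bool
open import Data.Empty using (⊥; ⊥-elim)
open import Data.Fin as Fin using (Fin; zero; suc; splitAt; toℕ; fromℕ<; punchOut; _↑ˡ_; _↑ʳ_)
import Data.Fin.Properties as Fin
open import Data.Fin.Properties using (_≟_; any?; all?)
open import Data.List using (List; []; _∷_; allFin)
open import Data.List.Membership.Propositional using (_∈_)
open import Data.List.Membership.Propositional.Properties using (∈-allFin)
open import Data.List.Relation.Unary.Any using (here; there)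
open import Data.Nat as ℕ using (ℕ; zero; suc; _+_; _≤_; z≤n; s≤s)
import Data.Nat.Properties as ℕ
open import Data.Product using (Σ; ∃; ∃₂; _×_; _,_; proj₁; proj₂)
open import Data.Sum using (_⊎_; inj₁; inj₂; [_,_]′)
open import Function.Base using (id; _∘_; case_of_)
open import Function.Bundles using (_⇔_; _↔_; Inverse; Injection; mk⇔; mk↔ₛ′)
open import Function.Definitions using (Injective)
open import Function.Properties.Inverse using (↔⇒↣)
open import Relation.Binary.Definitions using (tri<; tri≈; tri>)
open import Relation.Binary.PropositionalEquality using (_≡_; _≢_; refl; sym; trans; cong; cong₂; subst; subst₂)
open import Relation.Nullary using (¬_; Dec; yes; no; does; contradiction)
open import Relation.Nullary.Decidable using (_×-dec_; _⊎-dec_; _→-dec_; ¬?; dec-true; dec-false; does-⇔; decidable-stable)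
open import Relation.Unary using (Decidable)

-- Booleans and finite sets

does-true⇒ : ∀ {a} {A : Set a} (A? : Dec A) → does A? ≡ true → A
does-true⇒ (yes a) _ = a

true≢false : ∀ {b} → b ≡ true → b ≢ false
true≢false refl ()

eqb⇒≡ : ∀ {m} {x y : Fin m} → eqb x y ≡ true → x ≡ y
eqb⇒≡ {x = x} {y} eq with x ≟ y
... | yes x≡y = x≡y
... | no _ = contradiction eq λ ()

insert : ∀ {m} → Fin m → (Fin m → Bool) → Fin m → Bool
insert z T y = eqb y z ∨ T y

insert-here : ∀ {m} (z : Fin m) T → insert z T z ≡ true
insert-here z T rewrite eqb-refl z = refl

insert-there : ∀ {m} (z : Fin m) T {y} → T y ≡ true → insert z T y ≡ true
insert-there z T Ty rewrite Ty = Bool.∨-zeroʳ _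

insert⁻ : ∀ {m} {z : Fin m} {T y} → insert z T y ≡ true → y ≡ z ⊎ T y ≡ true
insert⁻ {z = z} {T} {y} eq with y ≟ z
... | yes y≡z = inj₁ y≡z
... | no _ = inj₂ eq

-- Turns a decidable set of vertices into an index type `Fin k`; the rows and columns of the board
-- and the vertices of G' arise in this way.
enumerate : ∀ {m} {P : Fin m → Set} → Decidable P →
  ∃ λ k → Σ (Fin k → Fin m) λ e →
    Injective _≡_ _≡_ e × (∀ i → P (e i)) × (∀ {x} → P x → ∃ λ i → e i ≡ x)
enumerate {zero} P? = 0 , (λ ()) , (λ { {()} }) , (λ ()) , λ { {()} }
enumerate {suc m} P? with enumerate (λ x → P? (suc x)) | P? zero
... | k , e , e-inj , e-P , e-onto | no ¬p =
  k , suc ∘ e , e-inj ∘ Fin.suc-injective , e-P ,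
  λ { {zero} p → contradiction p ¬p
    ; {suc x} p → let i , eq = e-onto p in i , cong suc eq }
... | k , e , e-inj , e-P , e-onto | yes p =
  suc k , (λ { zero → zero ; (suc i) → suc (e i) }) ,
  (λ { {zero} {zero} _ → refl ; {suc i} {suc j} eq → cong suc (e-inj (Fin.suc-injective eq))
     ; {zero} {suc _} () ; {suc _} {zero} () }) ,
  (λ { zero → p ; (suc i) → e-P i }) ,
  λ { {zero} _ → zero , refl
    ; {suc x} q → let i , eq = e-onto q in suc i , cong suc eq }

bijection : ∀ {a b} {A : Set a} {B : Set b} (f : A → B) →
  Injective _≡_ _≡_ f → (∀ y → ∃ λ x → f x ≡ y) → A ↔ B
bijection f f-inj f-onto = mk↔ₛ′ f (λ y → proj₁ (f-onto y)) (λ y → proj₂ (f-onto y))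
  (λ x → f-inj (proj₂ (f-onto (f x))))

-- Greedy extension to maximal sets

module Extension {m} (R : Fin m → Fin m → Set) (R? : ∀ x y → Dec (R x y))
  (R-refl : ∀ {x} → R x x) (R-sym : ∀ {x y} → R x y → R y x) where

  Pairwise : (Fin m → Bool) → Set
  Pairwise T = ∀ {x y} → T x ≡ true → T y ≡ true → R x y

  -- Greedy scan: each listed vertex is inserted if it is compatible with everything chosen so far.
  -- A vertex compatible with the final set was compatible with the smaller set at its turn, hence
  -- was inserted. With `R` equal to `_≁_` this yields maximal stable sets, with `_≈_` maximal
  -- cliques.
  extend-along : ∀ (vs : List (Fin m)) T → Pairwise T →
    ∃ λ T' → (∀ {x} → T x ≡ true → T' x ≡ true) × Pairwise T' ×
      (∀ {z} → z ∈ vs → (∀ {t} → T' t ≡ true → R z t) → T' z ≡ true)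
  extend-along [] T T-pw = T , id , T-pw , λ ()
  extend-along (v ∷ vs) T T-pw with all? (λ t → (T t Bool.≟ true) →-dec R? v t)
  ... | yes vT = let T' , T⊆T' , T'-pw , T'-max = extend-along vs (insert v T) T⁺-pw in
    T' , T⊆T' ∘ insert-there v T , T'-pw ,
    λ { (here refl) _ → T⊆T' (insert-here v T) ; (there z∈vs) → T'-max z∈vs }
    where
    T⁺-pw : Pairwise (insert v T)
    T⁺-pw Tx Ty with insert⁻ {T = T} Tx | insert⁻ {T = T} Ty
    ... | inj₁ refl | inj₁ refl = R-refl
    ... | inj₁ refl | inj₂ y∈T = vT _ y∈T
    ... | inj₂ x∈T | inj₁ refl = R-sym (vT _ x∈T)
    ... | inj₂ x∈T | inj₂ y∈T = T-pw x∈T y∈T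
  ... | no ¬vT = let T' , T⊆T' , T'-pw , T'-max = extend-along vs T T-pw in
    T' , T⊆T' , T'-pw ,
    λ { (here refl) vT' → contradiction (λ _ → vT' ∘ T⊆T') ¬vT
      ; (there z∈vs) → T'-max z∈vs }

  extend : {P : Fin m → Set} → Decidable P → (∀ {x y} → P x → P y → R x y) →
    ∃ λ T → (∀ {x} → P x → T x ≡ true) × Pairwise T ×
      (∀ {z} → (∀ {t} → T t ≡ true → R z t) → T z ≡ true)
  extend P? P-pw =
    let T , P⊆T , T-pw , T-max = extend-along (allFin m) (λ x → does (P? x))
          (λ {x} {y} px py → P-pw (does-true⇒ (P? x) px) (does-true⇒ (P? y) py))
    in T , (λ {x} p → P⊆T (dec-true (P? x) p)) , T-pw , T-max (∈-allFin _)

-- Adjacency, cliques and stable sets of a graph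

module Adjacency (G : Graph) where

  V : Set
  V = Fin (n G)

  infix 4 _~_ _≁_ _≈_ _#_

  _~_ _≁_ _≈_ _#_ : V → V → Set
  x ~ y = adj G x y ≡ true
  x ≁ y = adj G x y ≡ false
  x ≈ y = x ≡ y ⊎ x ~ y
  x # y = x ≢ y × x ≁ y

  ~-sym : ∀ {x y} → x ~ y → y ~ x
  ~-sym {x} {y} = trans (adj-sym G y x)

  ≁-sym : ∀ {x y} → x ≁ y → y ≁ x
  ≁-sym {x} {y} = trans (adj-sym G y x)

  ≈-sym : ∀ {x y} → x ≈ y → y ≈ x
  ≈-sym (inj₁ x≡y) = inj₁ (sym x≡y)
  ≈-sym (inj₂ x~y) = inj₂ (~-sym x~y)

  #-sym : ∀ {x y} → x # y → y # x
  #-sym (x≢y , x≁y) = x≢y ∘ sym , ≁-sym x≁y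

  ~⇒¬≁ : ∀ {x y} → x ~ y → ¬ (x ≁ y)
  ~⇒¬≁ = true≢false

  ~⇒≢ : ∀ {x y} → x ~ y → x ≢ y
  ~⇒≢ {x} x~x refl = ~⇒¬≁ x~x (adj-irrefl G x)

  ≈⇒¬# : ∀ {x y} → x ≈ y → ¬ (x # y)
  ≈⇒¬# (inj₁ x≡y) (x≢y , _) = x≢y x≡y
  ≈⇒¬# (inj₂ x~y) (_ , x≁y) = ~⇒¬≁ x~y x≁y

  ≈∧≢⇒~ : ∀ {x y} → x ≈ y → x ≢ y → x ~ y
  ≈∧≢⇒~ (inj₁ x≡y) x≢y = contradiction x≡y x≢y
  ≈∧≢⇒~ (inj₂ x~y) _ = x~y

  ≈∧#⇒≢ : ∀ {x y z} → x ≈ y → y # z → x ≢ z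
  ≈∧#⇒≢ x≈y y#z refl = ≈⇒¬# (≈-sym x≈y) y#z

  ~∧≁⇒≢ : ∀ {x y z} → x ~ y → z ≁ y → x ≢ z
  ~∧≁⇒≢ x~y z≁y refl = ~⇒¬≁ x~y z≁y

  ~-or-≁ : ∀ x y → x ~ y ⊎ x ≁ y
  ~-or-≁ x y with adj G x y
  ... | true = inj₁ refl
  ... | false = inj₂ refl

  ≈-or-# : ∀ x y → x ≈ y ⊎ x # y
  ≈-or-# x y with x ≟ y | ~-or-≁ x y
  ... | yes x≡y | _ = inj₁ (inj₁ x≡y)
  ... | no _ | inj₁ x~y = inj₁ (inj₂ x~y)
  ... | no x≢y | inj₂ x≁y = inj₂ (x≢y , x≁y)

  ¬#⇒≈ : ∀ {x y} → ¬ (x # y) → x ≈ y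
  ¬#⇒≈ {x} {y} ¬x#y = [ id , (λ x#y → contradiction x#y ¬x#y) ]′ (≈-or-# x y)

  ¬~⇒≁ : ∀ {x y} → ¬ (x ~ y) → x ≁ y
  ¬~⇒≁ {x} {y} ¬x~y = [ (λ x~y → contradiction x~y ¬x~y) , id ]′ (~-or-≁ x y)

  _~?_ : ∀ x y → Dec (x ~ y)
  x ~? y = adj G x y Bool.≟ true

  _≁?_ : ∀ x y → Dec (x ≁ y)
  x ≁? y = adj G x y Bool.≟ false

  _≈?_ : ∀ x y → Dec (x ≈ y)
  x ≈? y = (x ≟ y) ⊎-dec (x ~? y)

  _#?_ : ∀ x y → Dec (x # y)
  x #? y = ¬? (x ≟ y) ×-dec (x ≁? y)

  stable : ∀ {S} → IsMaxStable G S → ∀ {x y} → S x ≡ true → S y ≡ true → x ≁ y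
  stable (S-stable , _) = S-stable _ _

  stable-# : ∀ {S} → IsMaxStable G S → ∀ {x y} → S x ≡ true → S y ≡ true → x ≢ y → x # y
  stable-# S-max Sx Sy x≢y = x≢y , stable S-max Sx Sy

  clique : ∀ {C} → IsMaxClique G C → ∀ {x y} → C x ≡ true → C y ≡ true → x ≈ y
  clique (C-clique , _) Cx Cy = ¬#⇒≈ λ (x≢y , x≁y) → ~⇒¬≁ (C-clique _ _ Cx Cy x≢y) x≁y

  maxStable-absorbs : ∀ {S z} → IsMaxStable G S → (∀ {t} → S t ≡ true → z ≁ t) → S z ≡ true
  maxStable-absorbs {S} {z} S-max@(_ , S-maximal) z≁S =
    S-maximal (insert z S) S⁺-stable (λ _ → insert-there z S) z (insert-here z S)
    where
    S⁺-stable : IsStable G (insert z S)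
    S⁺-stable x y Sx Sy with insert⁻ {T = S} Sx | insert⁻ {T = S} Sy
    ... | inj₁ refl | inj₁ refl = adj-irrefl G z
    ... | inj₁ refl | inj₂ y∈S = z≁S y∈S
    ... | inj₂ x∈S | inj₁ refl = ≁-sym (z≁S x∈S)
    ... | inj₂ x∈S | inj₂ y∈S = stable S-max x∈S y∈S

  maxClique-absorbs : ∀ {C z} → IsMaxClique G C → (∀ {t} → C t ≡ true → z ≈ t) → C z ≡ true
  maxClique-absorbs {C} {z} C-max@(_ , C-maximal) z≈C =
    C-maximal (insert z C) C⁺-clique (λ _ → insert-there z C) z (insert-here z C)
    where
    C⁺-clique : IsClique G (insert z C)
    C⁺-clique x y Cx Cy x≢y with insert⁻ {T = C} Cx | insert⁻ {T = C} Cy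
    ... | inj₁ refl | inj₁ refl = contradiction refl x≢y
    ... | inj₁ refl | inj₂ y∈C = ≈∧≢⇒~ (z≈C y∈C) x≢y
    ... | inj₂ x∈C | inj₁ refl = ≈∧≢⇒~ (≈-sym (z≈C x∈C)) x≢y
    ... | inj₂ x∈C | inj₂ y∈C = ≈∧≢⇒~ (clique C-max x∈C y∈C) x≢y

  extend-stable : {P : V → Set} → Decidable P → (∀ {x y} → P x → P y → x ≁ y) →
    ∃ λ S → IsMaxStable G S × (∀ {x} → P x → S x ≡ true)
  extend-stable P? P-stable =
    let S , P⊆S , S-stable , S-max = Extension.extend _≁_ _≁?_ (adj-irrefl G _) ≁-sym P? P-stable
    in S , ((λ _ _ → S-stable) , λ T T-stable S⊆T z Tz → S-max λ St → T-stable _ _ Tz (S⊆T _ St)) , P⊆S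

  extend-clique : {P : V → Set} → Decidable P → (∀ {x y} → P x → P y → x ≈ y) →
    ∃ λ C → IsMaxClique G C × (∀ {x} → P x → C x ≡ true)
  extend-clique P? P-clique =
    let C , P⊆C , C-clique , C-max = Extension.extend _≈_ _≈?_ (inj₁ refl) ≈-sym P? P-clique
    in C ,
       ((λ _ _ Cx Cy x≢y → ≈∧≢⇒~ (C-clique Cx Cy) x≢y) ,
        λ T T-clique C⊆T z Tz → C-max λ Ct →
          ¬#⇒≈ λ (z≢t , z≁t) → ~⇒¬≁ (T-clique _ _ Tz (C⊆T _ Ct) z≢t) z≁t) ,
       P⊆C

  true-twins : ∀ {x y} → (∀ {w} → x ≈ w → y ≈ w) → (∀ {w} → y ≈ w → x ≈ w) → TrueTwins G x y
  true-twins x⊆y y⊆x z = swap ∘ x⊆y ∘ unswap , swap ∘ y⊆x ∘ unswap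
    where
    swap : ∀ {u} → u ≈ z → InClosedNbhd G u z
    swap = [ inj₁ ∘ sym , inj₂ ]′
    unswap : ∀ {u} → InClosedNbhd G u z → u ≈ z
    unswap = [ inj₁ ∘ sym , inj₂ ]′

  -- Induction along a path; every use of connectedness goes through it.
  reach-closed : {P : V → Set} → (∀ {x y} → P x → x ~ y → P y) → ∀ {x y} → Reach G x y → P x → P y
  reach-closed P-closed here Px = Px
  reach-closed P-closed (step x~y r) Px = reach-closed P-closed r (P-closed Px x~y)

-- Local structure of claw-free CIS graphs

module ClawFreeCIS (G : Graph) (clawFree : ClawFree G) (cis : CIS G) where
  open Adjacency G

  claw : ∀ {x a b c} → x ~ a → x ~ b → x ~ c → a # b → a # c → b # c → ⊥
  claw x~a x~b x~c (a≢b , a≁b) (a≢c , a≁c) (b≢c , b≁c) =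
    clawFree _ _ _ _ a≢b a≢c b≢c x~a x~b x~c a≁b a≁c b≁c

  -- `z` is the common vertex of a maximal clique containing `K` and a maximal stable set containing
  -- `T`. It may itself lie in `K` or in `T`, hence `≈` on one side and `≁` rather than `#` on the
  -- other.
  meet : {K T : V → Set} → Decidable K → Decidable T →
    (∀ {x y} → K x → K y → x ≈ y) → (∀ {x y} → T x → T y → x ≁ y) →
    ∃ λ z → (∀ {k} → K k → z ≈ k) × (∀ {t} → T t → z ≁ t)
  meet K? T? K-clique T-stable =
    let C , C-max , K⊆C = extend-clique K? K-clique
        S , S-max , T⊆S = extend-stable T? T-stable
        z , Cz , Sz = cis C S C-max S-max
    in z , clique C-max Cz ∘ K⊆C , stable S-max Sz ∘ T⊆S

  meet-edge : {T : V → Set} → Decidable T → (∀ {x y} → T x → T y → x ≁ y) →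
    ∀ {a b} → a ≈ b → ∃ λ z → z ≈ a × z ≈ b × (∀ {t} → T t → z ≁ t)
  meet-edge T? T-stable {a} {b} a≈b =
    let z , z≈K , z≁T = meet (λ x → (x ≟ a) ⊎-dec (x ≟ b)) T? K-clique T-stable
    in z , z≈K (inj₁ refl) , z≈K (inj₂ refl) , z≁T
    where
    K-clique : ∀ {x y} → x ≡ a ⊎ x ≡ b → y ≡ a ⊎ y ≡ b → x ≈ y
    K-clique (inj₁ refl) (inj₁ refl) = inj₁ refl
    K-clique (inj₁ refl) (inj₂ refl) = a≈b
    K-clique (inj₂ refl) (inj₁ refl) = ≈-sym a≈b
    K-clique (inj₂ refl) (inj₂ refl) = inj₁ refl

  pair-stable : ∀ {a b} → a # b → ∀ {x y} → x ≡ a ⊎ x ≡ b → y ≡ a ⊎ y ≡ b → x ≁ y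
  pair-stable (_ , a≁b) (inj₁ refl) (inj₁ refl) = adj-irrefl G _
  pair-stable (_ , a≁b) (inj₁ refl) (inj₂ refl) = a≁b
  pair-stable (_ , a≁b) (inj₂ refl) (inj₁ refl) = ≁-sym a≁b
  pair-stable (_ , a≁b) (inj₂ refl) (inj₂ refl) = adj-irrefl G _

  -- If p' and q' were equal or adjacent, a maximal clique through x, p', q' would avoid p and q,
  -- so its common vertex with a maximal stable set through p and q would give a claw at x.
  neighbourhood-co-P₄ : ∀ {x p q p' q'} → x ~ p → x ~ q → x ~ p' → x ~ q' →
    p' # p → p # q → q # q' → p' # q'
  neighbourhood-co-P₄ {x} {p} {q} {p'} {q'} x~p x~q x~p' x~q' p'#p p#q q#q' with ≈-or-# p' q'
  ... | inj₂ p'#q' = p'#q'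
  ... | inj₁ p'≈q' =
    let z , z≈K , z≁T = meet (λ y → (y ≟ x) ⊎-dec (y ≟ p') ⊎-dec (y ≟ q'))
                             (λ y → (y ≟ p) ⊎-dec (y ≟ q)) K-clique (pair-stable p#q)
        z#p = ≈∧#⇒≢ (z≈K (inj₂ (inj₁ refl))) p'#p , z≁T (inj₁ refl)
        z#q = ≈∧#⇒≢ (z≈K (inj₂ (inj₂ refl))) (#-sym q#q') , z≁T (inj₂ refl)
        x~z = ≈∧≢⇒~ (≈-sym (z≈K (inj₁ refl))) (~∧≁⇒≢ x~p (z≁T (inj₁ refl)))
    in ⊥-elim (claw x~p x~q x~z p#q (#-sym z#p) (#-sym z#q))
    where
    K-clique : ∀ {u v} → u ≡ x ⊎ u ≡ p' ⊎ u ≡ q' → v ≡ x ⊎ v ≡ p' ⊎ v ≡ q' → u ≈ v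
    K-clique (inj₁ refl) (inj₁ refl) = inj₁ refl
    K-clique (inj₁ refl) (inj₂ (inj₁ refl)) = inj₂ x~p'
    K-clique (inj₁ refl) (inj₂ (inj₂ refl)) = inj₂ x~q'
    K-clique (inj₂ (inj₁ refl)) (inj₁ refl) = inj₂ (~-sym x~p')
    K-clique (inj₂ (inj₁ refl)) (inj₂ (inj₁ refl)) = inj₁ refl
    K-clique (inj₂ (inj₁ refl)) (inj₂ (inj₂ refl)) = p'≈q'
    K-clique (inj₂ (inj₂ refl)) (inj₁ refl) = inj₂ (~-sym x~q')
    K-clique (inj₂ (inj₂ refl)) (inj₂ (inj₁ refl)) = ≈-sym p'≈q'
    K-clique (inj₂ (inj₂ refl)) (inj₂ (inj₂ refl)) = inj₁ refl

  NoStableTriple : Set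
  NoStableTriple = ∀ {a b c} → a # b → a # c → b # c → ⊥

  -- Wheels with four spokes

  -- The hub is `x` and the rim is the induced four-cycle p r q s, with opposite pairs p, q and r,
  -- s.
  record Wheel (x p q r s : V) : Set where
    field
      x~p : x ~ p
      x~q : x ~ q
      x~r : x ~ r
      x~s : x ~ s
      p#q : p # q
      r#s : r # s
      p~r : p ~ r
      p~s : p ~ s
      q~r : q ~ r
      q~s : q ~ s

  reflect : ∀ {x p q r s} → Wheel x p q r s → Wheel x q p r s
  reflect w = record
    { x~p = x~q ; x~q = x~p ; x~r = x~r ; x~s = x~s ; p#q = #-sym p#q ; r#s = r#s
    ; p~r = q~r ; p~s = q~s ; q~r = p~r ; q~s = p~s }
    where open Wheel w

  module _ {x p q r s : V} (w : Wheel x p q r s) where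
    open Wheel w

    -- If `y` missed a rim vertex `t` among r, s, then q, p, y, t would be a path of non-adjacencies
    -- in the neighbourhood of the hub, and `neighbourhood-co-P₄` would give `q # t`.
    miss-rim : ∀ {y} → x ~ y → y # p → y ~ r × y ~ s
    miss-rim {y} x~y y#p = adjacent x~r p~r q~r , adjacent x~s p~s q~s
      where
      adjacent : ∀ {t} → x ~ t → p ~ t → q ~ t → y ~ t
      adjacent x~t p~t q~t = ≈∧≢⇒~
        (¬#⇒≈ λ y#t → ≈⇒¬# (inj₂ q~t)
          (neighbourhood-co-P₄ x~p x~y x~q x~t (#-sym p#q) (#-sym y#p) y#t))
        λ { refl → ≈⇒¬# (inj₂ (~-sym p~t)) y#p }

  opposite-pair : ∀ {x p q r s} → Wheel x p q r s → ∀ {y} → x ~ y →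
    (y ~ p × y ~ q) ⊎ (y ~ r × y ~ s)
  opposite-pair {x} {p} {q} w {y} x~y with ≈-or-# y p | ≈-or-# y q
  ... | inj₂ y#p | _ = inj₂ (miss-rim w x~y y#p)
  ... | inj₁ _ | inj₂ y#q = inj₂ (miss-rim (reflect w) x~y y#q)
  ... | inj₁ (inj₁ refl) | inj₁ _ = inj₂ (Wheel.p~r w , Wheel.p~s w)
  ... | inj₁ (inj₂ _) | inj₁ (inj₁ refl) = inj₂ (Wheel.q~r w , Wheel.q~s w)
  ... | inj₁ (inj₂ y~p) | inj₁ (inj₂ y~q) = inj₁ (y~p , y~q)

  -- Otherwise x, z, j, j' would be a path of non-adjacencies in the neighbourhood of `y`, forcing
  -- `x # j'`.
  transfer : ∀ {x y j j' z} → x ~ y → x ~ j → x ~ j' → j # j' → y ~ j → y ~ j' →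
    y ~ z → z # x → z ~ j
  transfer x~y x~j x~j' j#j' y~j y~j' y~z z#x = ≈∧≢⇒~
    (¬#⇒≈ λ z#j → ≈⇒¬# (inj₂ x~j')
      (neighbourhood-co-P₄ y~z y~j (~-sym x~y) y~j' (#-sym z#x) z#j j#j'))
    λ { refl → ≈⇒¬# (inj₂ (~-sym x~j)) z#x }

  module _ (connected : Connected G) {x p q r s : V} (w : Wheel x p q r s) where
    open Wheel w

    Far : V → Set
    Far z = z # x × z ~ p × z ~ q × z ~ r × z ~ s

    -- The vertex `y` sees an opposite pair of the rim, and `transfer` at `y` makes `z` adjacent to
    -- that pair. A second `transfer`, at a member of this pair, reaches the other pair, because
    -- each rim vertex sees the hub and both ends of the pair opposite to its own.
    leave-neighbourhood : ∀ {y z} → x ~ y → y ~ z → z # x → Far z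
    leave-neighbourhood {y} {z} x~y y~z z#x with opposite-pair w x~y
    ... | inj₁ (y~p , y~q) = z#x , z~p , z~q ,
          transfer x~p x~r x~s r#s p~r p~s (~-sym z~p) z#x ,
          transfer x~p x~s x~r (#-sym r#s) p~s p~r (~-sym z~p) z#x
      where
      z~p : z ~ p
      z~p = transfer x~y x~p x~q p#q y~p y~q y~z z#x
      z~q : z ~ q
      z~q = transfer x~y x~q x~p (#-sym p#q) y~q y~p y~z z#x
    ... | inj₂ (y~r , y~s) = z#x ,
          transfer x~r x~p x~q p#q (~-sym p~r) (~-sym q~r) (~-sym z~r) z#x ,
          transfer x~r x~q x~p (#-sym p#q) (~-sym q~r) (~-sym p~r) (~-sym z~r) z#x ,
          z~r , z~s
      where
      z~r : z ~ r
      z~r = transfer x~y x~r x~s r#s y~r y~s y~z z#x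
      z~s : z ~ s
      z~s = transfer x~y x~s x~r (#-sym r#s) y~s y~r y~z z#x

    -- No path gets beyond the far vertices: a neighbour `b` of a far vertex `a` must equal or see p
    -- or q, since p, q, b would otherwise be a claw at `a`. So `b` is again within two steps of the
    -- hub.
    near-or-far : ∀ t → x ≈ t ⊎ Far t
    near-or-far t = reach-closed closed (connected x t) (inj₁ (inj₁ refl))
      where
      closed : ∀ {a b} → x ≈ a ⊎ Far a → a ~ b → x ≈ b ⊎ Far b
      closed {a} {b} near a~b with ≈-or-# x b
      closed _ _ | inj₁ x≈b = inj₁ x≈b
      closed (inj₁ (inj₁ refl)) a~b | inj₂ _ = inj₁ (inj₂ a~b)
      closed (inj₁ (inj₂ x~a)) a~b | inj₂ x#b = inj₂ (leave-neighbourhood x~a a~b (#-sym x#b))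
      closed {a} {b} (inj₂ (a#x , a~p , a~q , a~r , a~s)) a~b | inj₂ x#b
        with ≈-or-# b p | ≈-or-# b q
      ... | inj₁ b≈p | _ = inj₂ (leave-neighbourhood x~p
              (~-sym (≈∧≢⇒~ b≈p λ { refl → ≈⇒¬# (inj₂ x~p) x#b })) (#-sym x#b))
      ... | inj₂ _ | inj₁ b≈q = inj₂ (leave-neighbourhood x~q
              (~-sym (≈∧≢⇒~ b≈q λ { refl → ≈⇒¬# (inj₂ x~q) x#b })) (#-sym x#b))
      ... | inj₂ b#p | inj₂ b#q = ⊥-elim (claw a~p a~q a~b p#q (#-sym b#p) (#-sym b#q))

    -- Let `j` see the pair p, q. Then `j'` sees p, since j, j', p, q would otherwise be a path of
    -- non-adjacencies around the hub. Now p sees x, j, j' and t, and `transfer` at p gives `t ~ j`.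
    -- The pair r, s is treated alike.
    far-near-near : ∀ {t j j'} → Far t → x ≈ j → x ≈ j' → ¬ (j # t × j # j')
    far-near-near _ (inj₁ refl) x≈j' (_ , x#j') = ≈⇒¬# x≈j' x#j'
    far-near-near _ x≈j (inj₁ refl) (_ , j#x) = ≈⇒¬# (≈-sym x≈j) j#x
    far-near-near {t} {j} {j'} (t#x , t~p , _ , t~r , _) (inj₂ x~j) (inj₂ x~j') (j#t , j#j')
      with opposite-pair w x~j
    ... | inj₁ (j~p , j~q) = ≈⇒¬# (inj₂ (~-sym (transfer x~p x~j x~j' j#j' (~-sym j~p) p~j' (~-sym t~p) t#x))) j#t
      where
      p~j' : p ~ j'
      p~j' = ~-sym (≈∧≢⇒~
        (¬#⇒≈ λ j'#p → ≈⇒¬# (inj₂ j~q) (neighbourhood-co-P₄ x~j' x~p x~j x~q j#j' j'#p p#q))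
        λ { refl → ≈⇒¬# (inj₂ j~p) j#j' })
    ... | inj₂ (j~r , j~s) = ≈⇒¬# (inj₂ (~-sym (transfer x~r x~j x~j' j#j' (~-sym j~r) r~j' (~-sym t~r) t#x))) j#t
      where
      r~j' : r ~ j'
      r~j' = ~-sym (≈∧≢⇒~
        (¬#⇒≈ λ j'#r → ≈⇒¬# (inj₂ j~s) (neighbourhood-co-P₄ x~j' x~r x~j x~s j#j' j'#r r#s))
        λ { refl → ≈⇒¬# (inj₂ j~r) j#j' })

    far-far : ∀ {t t'} → Far t → Far t' → ¬ (t # t')
    far-far (t#x , t~p , _) (t'#x , t'~p , _) t#t' =
      claw (~-sym x~p) (~-sym t~p) (~-sym t'~p) (#-sym t#x) (#-sym t'#x) t#t'

    near-near-near : ∀ {a b c} → x ≈ a → x ≈ b → x ≈ c → a # b → a # c → b # c → ⊥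
    near-near-near (inj₁ refl) x≈b _ a#b _ _ = ≈⇒¬# x≈b a#b
    near-near-near x≈a (inj₁ refl) _ a#b _ _ = ≈⇒¬# (≈-sym x≈a) a#b
    near-near-near x≈a _ (inj₁ refl) _ a#c _ = ≈⇒¬# (≈-sym x≈a) a#c
    near-near-near (inj₂ x~a) (inj₂ x~b) (inj₂ x~c) = claw x~a x~b x~c

    -- Three near vertices would be a claw at the hub or involve the hub itself; `far-near-near`
    -- excludes exactly one far vertex and `far-far` excludes two or more.
    wheel⇒noStableTriple : NoStableTriple
    wheel⇒noStableTriple {a} {b} {c} a#b a#c b#c with near-or-far a | near-or-far b | near-or-far c
    ... | inj₁ na | inj₁ nb | inj₁ nc = near-near-near na nb nc a#b a#c b#c
    ... | inj₁ na | inj₁ nb | inj₂ fc = far-near-near fc na nb (a#c , a#b)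
    ... | inj₁ na | inj₂ fb | inj₁ nc = far-near-near fb na nc (a#b , a#c)
    ... | inj₂ fa | inj₁ nb | inj₁ nc = far-near-near fa nb nc (#-sym a#b , b#c)
    ... | inj₂ fa | inj₂ fb | _ = far-far fa fb a#b
    ... | inj₂ fa | inj₁ _ | inj₂ fc = far-far fa fc a#c
    ... | inj₁ _ | inj₂ fb | inj₂ fc = far-far fb fc b#c

  -- From diamonds to wheels

  Diamond : Set
  Diamond = ∃₂ λ u v → ∃₂ λ a b → u ~ v × u ~ a × u ~ b × v ~ a × v ~ b × a # b

  diamond? : Dec Diamond
  diamond? = any? λ u → any? λ v → any? λ a → any? λ b →
    u ~? v ×-dec u ~? a ×-dec u ~? b ×-dec v ~? a ×-dec v ~? b ×-dec a #? b

  -- A vertex `w` that separates the central vertices closes the rim a v b w around the hub `u`: if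
  -- `w` missed one of a, b, then v, w and these two would form a path of non-adjacencies around
  -- `u`, making `v` miss the other one.
  distinguished⇒wheel : ∀ {u v a b w} → u ~ v → u ~ a → u ~ b → v ~ a → v ~ b → a # b →
    u ≈ w → v # w → Wheel u a b v w
  distinguished⇒wheel {u} {v} {a} {b} {w} u~v u~a u~b v~a v~b a#b u≈w v#w = record
    { x~p = u~a ; x~q = u~b ; x~r = u~v ; x~s = u~w ; p#q = a#b ; r#s = v#w
    ; p~r = ~-sym v~a ; p~s = ~-sym (adjacent u~a u~b v~a v~b a#b)
    ; q~r = ~-sym v~b ; q~s = ~-sym (adjacent u~b u~a v~b v~a (#-sym a#b)) }
    where
    u~w : u ~ w
    u~w = ≈∧≢⇒~ u≈w λ { refl → ≈⇒¬# (inj₂ (~-sym u~v)) v#w }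
    adjacent : ∀ {c d} → u ~ c → u ~ d → v ~ c → v ~ d → c # d → w ~ c
    adjacent u~c u~d v~c v~d c#d = ≈∧≢⇒~
      (¬#⇒≈ λ w#c → ≈⇒¬# (inj₂ v~d) (neighbourhood-co-P₄ u~w u~c u~v u~d v#w w#c c#d))
      λ { refl → ≈⇒¬# (inj₂ v~c) v#w }

  diamond⇒wheel : TrueTwinFree G → Diamond → ∃₂ λ x p → ∃₂ λ q r → ∃ λ s → Wheel x p q r s
  diamond⇒wheel twinFree (u , v , a , b , u~v , u~a , u~b , v~a , v~b , a#b)
    with any? (λ w → u ≈? w ×-dec v #? w) | any? (λ w → v ≈? w ×-dec u #? w)
  ... | yes (w , u≈w , v#w) | _ =
        _ , _ , _ , _ , _ , distinguished⇒wheel u~v u~a u~b v~a v~b a#b u≈w v#w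
  ... | no _ | yes (w , v≈w , u#w) =
        _ , _ , _ , _ , _ , distinguished⇒wheel (~-sym u~v) v~a v~b u~a u~b a#b v≈w u#w
  ... | no ¬u | no ¬v = ⊥-elim (twinFree u v (~⇒≢ u~v)
          (true-twins (λ u≈w → ¬#⇒≈ λ v#w → ¬u (_ , u≈w , v#w))
                      (λ v≈w → ¬#⇒≈ λ u#w → ¬v (_ , v≈w , u#w))))

  -- Graphs without stable triples

  module _ (α≤2 : NoStableTriple) (twinFree : TrueTwinFree G) where

    -- If `y ≈ w`, the vertex `z` obtained from this clique and the stable pair x, y' differs from
    -- both members of the pair and misses them, which is a stable triple. This is
    -- `neighbourhood-co-P₄` for the whole graph.
    co-P₄ : ∀ {y x y' w} → y # x → x # y' → y' # w → y # w
    co-P₄ {y} {x} {y'} {w} y#x x#y' y'#w with ≈-or-# y w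
    ... | inj₂ y#w = y#w
    ... | inj₁ y≈w =
      let z , z≈y , z≈w , z≁T = meet-edge (λ t → (t ≟ x) ⊎-dec (t ≟ y')) (pair-stable x#y') y≈w
      in ⊥-elim (α≤2 x#y' (#-sym (≈∧#⇒≢ z≈y y#x , z≁T (inj₁ refl)))
                          (#-sym (≈∧#⇒≢ z≈w (#-sym y'#w) , z≁T (inj₂ refl))))

    -- Two non-neighbours `a`, `b` of `x` are twins: if `b` misses `w`, then a, x, b, w is a path of
    -- non-adjacencies and `a` misses `w` too.
    non-neighbour-unique : ∀ {x y y'} → x # y → x # y' → y ≡ y'
    non-neighbour-unique {x} {y} {y'} x#y x#y' with y ≟ y'
    ... | yes y≡y' = y≡y'
    ... | no y≢y' = ⊥-elim (twinFree y y' y≢y' (true-twins (sub x#y x#y') (sub x#y' x#y)))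
      where
      sub : ∀ {a b} → x # a → x # b → ∀ {w} → a ≈ w → b ≈ w
      sub x#a x#b a≈w = ¬#⇒≈ λ b#w → ≈⇒¬# a≈w (co-P₄ (#-sym x#a) x#b b#w)

    universal-unique : ∀ {x y} → (∀ w → x ≈ w) → (∀ w → y ≈ w) → x ≡ y
    universal-unique {x} {y} x-univ y-univ with x ≟ y
    ... | yes x≡y = x≡y
    ... | no x≢y = ⊥-elim (twinFree x y x≢y (true-twins (λ _ → y-univ _) (λ _ → x-univ _)))

-- Complements of pK₂ + qK₁

-- The cocktail party graph on p pairs, with one universal vertex added when q is 1.
cocktail : ℕ → ℕ → Graph
cocktail p q = complement ((p · K₂) ⊕ (q · K₁))

-- The vertex set of cocktail (suc p) q is definitionally that of cocktail p q with two vertices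
-- added in front.
cocktail-new : ∀ p q (c : Fin 2) j → adj (cocktail (suc p) q) (c ↑ˡ n (cocktail p q)) (suc (suc j)) ≡ true
cocktail-new p q zero j with splitAt (n (p · K₂)) j
... | inj₁ _ = refl
... | inj₂ _ = refl
cocktail-new p q (suc zero) j with splitAt (n (p · K₂)) j
... | inj₁ _ = refl
... | inj₂ _ = refl

cocktail-old : ∀ p q i j → adj (cocktail (suc p) q) (suc (suc i)) (suc (suc j)) ≡ adj (cocktail p q) i j
cocktail-old p q i j with i ≟ j
... | yes _ = refl
... | no _ with splitAt (n (p · K₂)) i | splitAt (n (p · K₂)) j
... | inj₁ _ | inj₁ _ = refl
... | inj₁ _ | inj₂ _ = refl
... | inj₂ _ | inj₁ _ = refl
... | inj₂ _ | inj₂ _ = refl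

module _ (G : Graph) where
  open Adjacency G

  -- An isomorphism from `H` onto the subgraph induced by `U`; working with subsets lets the
  -- recursion remove one non-adjacent pair at a time.
  record Enumerates (U : V → Set) (H : Graph) : Set where
    field
      vertex : Fin (n H) → V
      injective : Injective _≡_ _≡_ vertex
      sound : ∀ i → U (vertex i)
      complete : ∀ {x} → U x → ∃ λ i → vertex i ≡ x
      preserves : ∀ i j → adj G (vertex i) (vertex j) ≡ adj H i j

  enumerates⇒≅ : ∀ {U H} → (∀ x → U x) → Enumerates U H → G ≅ H
  enumerates⇒≅ {H = H} U-all e = record
    { iso = bijection index index-injective (λ i → vertex i , injective (vertex-index _))
    ; preserve = λ x y → trans (cong₂ (adj G) (sym (vertex-index x)) (sym (vertex-index y)))
                               (preserves (index x) (index y)) }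
    where
    open Enumerates e
    index : V → Fin (n H)
    index x = proj₁ (complete (U-all x))
    vertex-index : ∀ x → vertex (index x) ≡ x
    vertex-index x = proj₂ (complete (U-all x))
    index-injective : Injective _≡_ _≡_ index
    index-injective {x} {y} eq =
      trans (sym (vertex-index x)) (trans (cong vertex eq) (vertex-index y))

  module _ (non-neighbour-unique : ∀ {x y z} → x # y → x # z → y ≡ z)
           (universal-unique : ∀ {x y} → (∀ w → x ≈ w) → (∀ w → y ≈ w) → x ≡ y) where

    Without : (V → Set) → V → V → V → Set
    Without U v w x = U x × x ≢ v × x ≢ w

    -- As `v` and `w` are each other's only non-neighbours, both are adjacent to everything
    -- enumerated before, just as the two front vertices of the larger cocktail graph are.
    add-pair : ∀ {U v w} p q → U v → U w → v # w → Enumerates (Without U v w) (cocktail p q) →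
      Enumerates U (cocktail (suc p) q)
    add-pair {U} {v} {w} p q Uv Uw v#w@(v≢w , v≁w) e = record
      { vertex = vertex⁺ ; injective = injective⁺ ; sound = sound⁺
      ; complete = complete⁺ ; preserves = preserves⁺ }
      where
      open Enumerates e
      vertex⁺ : Fin (n (cocktail (suc p) q)) → V
      vertex⁺ zero = v
      vertex⁺ (suc zero) = w
      vertex⁺ (suc (suc i)) = vertex i

      ≢v : ∀ i → vertex i ≢ v
      ≢v i = proj₁ (proj₂ (sound i))
      ≢w : ∀ i → vertex i ≢ w
      ≢w i = proj₂ (proj₂ (sound i))

      injective⁺ : Injective _≡_ _≡_ vertex⁺
      injective⁺ {zero} {zero} _ = refl
      injective⁺ {zero} {suc zero} eq = contradiction eq v≢w
      injective⁺ {zero} {suc (suc j)} eq = contradiction (sym eq) (≢v j)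
      injective⁺ {suc zero} {zero} eq = contradiction (sym eq) v≢w
      injective⁺ {suc zero} {suc zero} _ = refl
      injective⁺ {suc zero} {suc (suc j)} eq = contradiction (sym eq) (≢w j)
      injective⁺ {suc (suc i)} {zero} eq = contradiction eq (≢v i)
      injective⁺ {suc (suc i)} {suc zero} eq = contradiction eq (≢w i)
      injective⁺ {suc (suc i)} {suc (suc j)} eq = cong (λ k → suc (suc k)) (injective eq)

      sound⁺ : ∀ i → U (vertex⁺ i)
      sound⁺ zero = Uv
      sound⁺ (suc zero) = Uw
      sound⁺ (suc (suc i)) = proj₁ (sound i)

      complete⁺ : ∀ {x} → U x → ∃ λ i → vertex⁺ i ≡ x
      complete⁺ {x} Ux with x ≟ v | x ≟ w
      ... | yes refl | _ = zero , refl
      ... | no _ | yes refl = suc zero , refl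
      ... | no x≢v | no x≢w = let i , eq = complete (Ux , x≢v , x≢w) in suc (suc i) , eq

      v~ : ∀ j → v ~ vertex j
      v~ j = ≈∧≢⇒~ (¬#⇒≈ λ v#j → ≢w j (non-neighbour-unique v#j v#w)) (≢v j ∘ sym)
      w~ : ∀ j → w ~ vertex j
      w~ j = ≈∧≢⇒~ (¬#⇒≈ λ w#j → ≢v j (non-neighbour-unique w#j (#-sym v#w))) (≢w j ∘ sym)

      H : Graph
      H = cocktail (suc p) q

      preserves⁺ : ∀ i j → adj G (vertex⁺ i) (vertex⁺ j) ≡ adj H i j
      preserves⁺ zero zero = adj-irrefl G v
      preserves⁺ zero (suc zero) = v≁w
      preserves⁺ zero (suc (suc j)) = trans (v~ j) (sym (cocktail-new p q zero j))
      preserves⁺ (suc zero) zero = ≁-sym v≁w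
      preserves⁺ (suc zero) (suc zero) = adj-irrefl G w
      preserves⁺ (suc zero) (suc (suc j)) = trans (w~ j) (sym (cocktail-new p q (suc zero) j))
      preserves⁺ (suc (suc i)) zero = trans (~-sym (v~ i))
        (sym (trans (adj-sym H (suc (suc i)) zero) (cocktail-new p q zero i)))
      preserves⁺ (suc (suc i)) (suc zero) = trans (~-sym (w~ i))
        (sym (trans (adj-sym H (suc (suc i)) (suc zero)) (cocktail-new p q (suc zero) i)))
      preserves⁺ (suc (suc i)) (suc (suc j)) = trans (preserves i j) (sym (cocktail-old p q i j))

    -- Recursion on the vertices still to be processed. The invariant is that `U` is closed under
    -- non-adjacency and that its members outside the list are universal. A head with a
    -- non-neighbour leaves `U` together with that non-neighbour; a universal head stays in `U`.
    -- When the list is exhausted, only universal vertices remain, hence at most one, and this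
    -- decides q.
    enumerate-cocktail : ∀ vs {U : V → Set} → Decidable U → (∀ {x y} → U x → x # y → U y) →
      (∀ {x} → U x → x ∈ vs ⊎ (∀ w → x ≈ w)) →
      ∃₂ λ p q → q ≤ 1 × Enumerates U (cocktail p q)
    enumerate-cocktail [] U? _ universal with any? U?
    ... | yes (x , Ux) = 0 , 1 , ℕ.≤-refl , record
      { vertex = λ _ → x
      ; injective = λ { {zero} {zero} _ → refl }
      ; sound = λ _ → Ux
      ; complete = λ Uy → zero , universal-unique (universal′ Ux) (universal′ Uy)
      ; preserves = λ { zero zero → adj-irrefl G x } }
      where
      universal′ : ∀ {y} → _ → ∀ w → y ≈ w
      universal′ Uy with universal Uy
      ... | inj₂ y-univ = y-univ
    ... | no ¬U = 0 , 0 , z≤n , record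
      { vertex = λ () ; injective = λ { {()} } ; sound = λ ()
      ; complete = λ Ux → contradiction (_ , Ux) ¬U ; preserves = λ () }
    enumerate-cocktail (v ∷ vs) {U} U? U-closed universal with U? v | any? (v #?_)
    ... | no ¬Uv | _ = enumerate-cocktail vs U? U-closed universal′
      where
      universal′ : ∀ {x} → U x → x ∈ vs ⊎ (∀ w → x ≈ w)
      universal′ Ux with universal Ux
      ... | inj₁ (here refl) = contradiction Ux ¬Uv
      ... | inj₁ (there x∈vs) = inj₁ x∈vs
      ... | inj₂ x-univ = inj₂ x-univ
    ... | yes _ | no ¬v# = enumerate-cocktail vs U? U-closed universal′
      where
      universal′ : ∀ {x} → U x → x ∈ vs ⊎ (∀ w → x ≈ w)
      universal′ Ux with universal Ux
      ... | inj₁ (here refl) = inj₂ λ w → ¬#⇒≈ λ v#w → ¬v# (w , v#w)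
      ... | inj₁ (there x∈vs) = inj₁ x∈vs
      ... | inj₂ x-univ = inj₂ x-univ
    ... | yes Uv | yes (w , v#w) =
      let p , q , q≤1 , e = enumerate-cocktail vs
            (λ x → U? x ×-dec ¬? (x ≟ v) ×-dec ¬? (x ≟ w)) closed′ universal′
      in suc p , q , q≤1 , add-pair p q Uv (U-closed Uv v#w) v#w e
      where
      closed′ : ∀ {x y} → Without U v w x → x # y → Without U v w y
      closed′ (Ux , x≢v , x≢w) x#y = U-closed Ux x#y ,
        (λ { refl → x≢w (non-neighbour-unique (#-sym x#y) v#w) }) ,
        (λ { refl → x≢v (non-neighbour-unique (#-sym x#y) (#-sym v#w)) })
      universal′ : ∀ {x} → Without U v w x → x ∈ vs ⊎ (∀ w → x ≈ w)
      universal′ (Ux , x≢v , _) with universal Ux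
      ... | inj₁ (here refl) = contradiction refl x≢v
      ... | inj₁ (there x∈vs) = inj₁ x∈vs
      ... | inj₂ x-univ = inj₂ x-univ

    cocktail-iso : ∃₂ λ p q → q ≤ 1 × G ≅ cocktail p q
    cocktail-iso =
      -- The predicate `x ≡ x` stands for the full vertex set.
      let p , q , q≤1 , e = enumerate-cocktail (allFin _) {λ x → x ≡ x} (λ x → yes refl) (λ _ _ → refl)
                              (λ _ → inj₁ (∈-allFin _))
      in p , q , q≤1 , enumerates⇒≅ {H = cocktail p q} (λ _ → refl) e

-- The complements of pK₂ + qK₁ are CIS

MaxDegree≤1 : Graph → Set
MaxDegree≤1 H = ∀ {x y z} → adj H x y ≡ true → adj H x z ≡ true → y ≡ z

⊕-degree : ∀ G H → MaxDegree≤1 G → MaxDegree≤1 H → MaxDegree≤1 (G ⊕ H)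
⊕-degree G H dG dH {x} {y} {z} xy xz
  with splitAt (n G) x | splitAt (n G) y in eqy | splitAt (n G) z in eqz
... | inj₁ _ | inj₁ _ | inj₁ _ = trans (sym (Fin.splitAt⁻¹-↑ˡ eqy))
        (trans (cong (_↑ˡ n H) (dG xy xz)) (Fin.splitAt⁻¹-↑ˡ eqz))
... | inj₂ _ | inj₂ _ | inj₂ _ = trans (sym (Fin.splitAt⁻¹-↑ʳ {n G} eqy))
        (trans (cong (n G ↑ʳ_) (dH xy xz)) (Fin.splitAt⁻¹-↑ʳ {n G} eqz))

·-degree : ∀ k F → MaxDegree≤1 F → MaxDegree≤1 (k · F)
·-degree zero F dF {()}
·-degree (suc k) F dF = ⊕-degree F (k · F) dF (·-degree k F dF)

K₂-degree : MaxDegree≤1 K₂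
K₂-degree {zero} {suc zero} {suc zero} _ _ = refl
K₂-degree {suc zero} {zero} {zero} _ _ = refl
K₂-degree {suc zero} {suc zero} ()
K₂-degree {suc zero} {zero} {suc zero} _ ()

K₁-degree : MaxDegree≤1 K₁
K₁-degree {zero} {zero} ()

module _ (G : Graph) (p q : ℕ) (G≅ : G ≅ cocktail p q) where
  open Adjacency G
  open _≅_ G≅

  cocktail-non-neighbour : ∀ {x y} → x # y →
    adj ((p · K₂) ⊕ (q · K₁)) (Inverse.to iso x) (Inverse.to iso y) ≡ true
  cocktail-non-neighbour {x} {y} (x≢y , x≁y)
    with Inverse.to iso x ≟ Inverse.to iso y | trans (sym (preserve x y)) x≁y
  ... | yes eq | _ = contradiction (Injection.injective (↔⇒↣ iso) eq) x≢y
  ... | no _ | eq = trans (sym (Bool.not-involutive _)) (cong not eq)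

  -- Take `s` in S. If `s` misses no member of C, it belongs to C by maximality. Otherwise it misses
  -- some `c` in C; this is its only non-neighbour, so S has no members besides s and c, and
  -- maximality puts `c` into S.
  cocktail-cis : 1 ≤ n G → CIS G
  cocktail-cis 1≤n C S C-max S-max with any? (λ s → S s Bool.≟ true)
  -- An empty S would absorb any vertex, and the graph is non-null.
  ... | no ¬S = contradiction
          (fromℕ< 1≤n , maxStable-absorbs S-max (λ St → contradiction (_ , St) ¬S)) ¬S
  ... | yes (s , Ss) with any? (λ c → (C c Bool.≟ true) ×-dec (s #? c))
  ... | no ¬c = s , maxClique-absorbs C-max (λ Cc → ¬#⇒≈ λ s#c → ¬c (_ , Cc , s#c)) , Ss
  ... | yes (c , Cc , s#c) = c , Cc , maxStable-absorbs S-max c≁S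
    where
    c≁S : ∀ {t} → S t ≡ true → c ≁ t
    c≁S {t} St with s ≟ t
    ... | yes refl = ≁-sym (proj₂ s#c)
    ... | no s≢t = subst (c ≁_) (Injection.injective (↔⇒↣ iso)
            (⊕-degree (p · K₂) (q · K₁) (·-degree p K₂ K₂-degree) (·-degree q K₁ K₁-degree)
              (cocktail-non-neighbour s#c)
              (cocktail-non-neighbour (stable-# S-max Ss St s≢t))))
            (adj-irrefl G c)

-- Diamond-free CIS graphs and simplicial vertices

module DiamondFreeCIS (G : Graph) (clawFree : ClawFree G) (cis : CIS G)
  (¬diamond : ¬ ClawFreeCIS.Diamond G clawFree cis) where
  open Adjacency G
  open ClawFreeCIS G clawFree cis

  diamond-free : ∀ {u v a b} → u ~ v → u ~ a → u ~ b → v ~ a → v ~ b → a ≈ b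
  diamond-free u~v u~a u~b v~a v~b =
    ¬#⇒≈ λ a#b → ¬diamond (_ , _ , _ , _ , u~v , u~a , u~b , v~a , v~b , a#b)

  NonSimplicial Simplicial : V → Set
  NonSimplicial x = ∃₂ λ a b → x ~ a × x ~ b × a # b
  Simplicial x = ¬ NonSimplicial x

  nonSimplicial? : Decidable NonSimplicial
  nonSimplicial? x = any? λ a → any? λ b → x ~? a ×-dec x ~? b ×-dec a #? b

  simplicial? : Decidable Simplicial
  simplicial? x = ¬? (nonSimplicial? x)

  simplicial-≈ : ∀ {x a b} → Simplicial x → x ~ a → x ~ b → a ≈ b
  simplicial-≈ x-simp x~a x~b = ¬#⇒≈ λ a#b → x-simp (_ , _ , x~a , x~b , a#b)

  simplicial-closed-≈ : ∀ {x a b} → Simplicial x → x ≈ a → x ≈ b → a ≈ b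
  simplicial-closed-≈ _ (inj₁ refl) x≈b = x≈b
  simplicial-closed-≈ _ x≈a (inj₁ refl) = ≈-sym x≈a
  simplicial-closed-≈ x-simp (inj₂ x~a) (inj₂ x~b) = simplicial-≈ x-simp x~a x~b

  -- The closed neighbourhood of a simplicial vertex is a clique, so two adjacent simplicial
  -- vertices have equal closed neighbourhoods and are twins.
  simplicials-stable : TrueTwinFree G → ∀ {x y} → Simplicial x → Simplicial y → x ≁ y
  simplicials-stable twinFree x-simp y-simp = ¬~⇒≁ λ x~y → twinFree _ _ (~⇒≢ x~y)
    (true-twins (simplicial-closed-≈ x-simp (inj₂ x~y))
                (simplicial-closed-≈ y-simp (inj₂ (~-sym x~y))))

  -- One of the two non-adjacent neighbours of `t` works: if `v` saw both, they would form a diamond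
  -- with the edge from t to v, and if `v` is one of them, the other works.
  escape : ∀ {t v} → NonSimplicial t → t ~ v → ∃ λ e → t ~ e × e # v
  escape {t} {v} (a , b , t~a , t~b , a#b) t~v with ≈-or-# a v | ≈-or-# b v
  ... | inj₂ a#v | _ = a , t~a , a#v
  ... | inj₁ _ | inj₂ b#v = b , t~b , b#v
  ... | inj₁ (inj₁ refl) | inj₁ b≈a = ⊥-elim (≈⇒¬# (≈-sym b≈a) a#b)
  ... | inj₁ (inj₂ a~b) | inj₁ (inj₁ refl) = ⊥-elim (≈⇒¬# (inj₂ a~b) a#b)
  ... | inj₁ (inj₂ a~v) | inj₁ (inj₂ b~v) =
        ⊥-elim (≈⇒¬# (diamond-free t~v t~a t~b (~-sym a~v) (~-sym b~v)) a#b)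

  module _ {S : VSet G} (S-max : IsMaxStable G S)
           (simplicials⊆S : ∀ {x} → Simplicial x → S x ≡ true) where

    -- With `T` the whole of S, the vertex found misses S and hence lies in S by maximality.
    meet-S : ∀ {a b} → a ≈ b → ∃ λ z → z ≈ a × z ≈ b × S z ≡ true
    meet-S a≈b =
      let z , z≈a , z≈b , z≁S = meet-edge (λ x → S x Bool.≟ true) (stable S-max) a≈b
      in z , z≈a , z≈b , maxStable-absorbs S-max z≁S

    -- Seeing `t`, the vertex `c` is outside S and so not simplicial. It therefore has a neighbour
    -- `f # t`, and the member of S close to both c and f is neither `t`, because of f, nor `c`.
    second-neighbour : ∀ {c t} → S t ≡ true → c ~ t → ∃ λ u → S u ≡ true × c ~ u × u ≢ t
    second-neighbour {c} {t} St c~t with nonSimplicial? c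
    ... | no c-simp = ⊥-elim (~⇒¬≁ c~t (stable S-max (simplicials⊆S c-simp) St))
    ... | yes c-nonsimp =
      let f , c~f , f#t = escape c-nonsimp c~t
          z , z≈c , z≈f , Sz = meet-S (inj₂ c~f)
      in z , Sz , ≈∧≢⇒~ (≈-sym z≈c) (~∧≁⇒≢ c~t (stable S-max Sz St)) , ≈∧#⇒≢ z≈f f#t

    Exchanged : V → V → V → V → Set
    Exchanged s t v y = y ≡ v ⊎ (S y ≡ true × y ≢ s × y ≢ t)

    exchanged? : ∀ s t v → Decidable (Exchanged s t v)
    exchanged? s t v y = (y ≟ v) ⊎-dec ((S y Bool.≟ true) ×-dec ¬? (y ≟ s) ×-dec ¬? (y ≟ t))

    -- A third neighbour of `v` in S would form a claw at `v` with s and t.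
    exchanged-stable : ∀ {s t v} → S s ≡ true → S t ≡ true → s ≢ t → v ~ s → v ~ t →
      ∀ {x y} → Exchanged s t v x → Exchanged s t v y → x ≁ y
    exchanged-stable {s} {t} {v} Ss St s≢t v~s v~t = pairwise
      where
      v≁ : ∀ {y} → S y ≡ true × y ≢ s × y ≢ t → v ≁ y
      v≁ (Sy , y≢s , y≢t) = ¬~⇒≁ λ v~y → claw v~s v~t v~y (stable-# S-max Ss St s≢t)
        (stable-# S-max Ss Sy (y≢s ∘ sym)) (stable-# S-max St Sy (y≢t ∘ sym))
      pairwise : ∀ {x y} → Exchanged s t v x → Exchanged s t v y → x ≁ y
      pairwise (inj₁ refl) (inj₁ refl) = adj-irrefl G v
      pairwise (inj₁ refl) (inj₂ y∈) = v≁ y∈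
      pairwise (inj₂ x∈) (inj₁ refl) = ≁-sym (v≁ x∈)
      pairwise (inj₂ (Sx , _)) (inj₂ (Sy , _)) = stable S-max Sx Sy

    -- Replacing s and t by v in S must not miss the cliques through t that avoid v.
    exchange : ∀ {s t v} → S s ≡ true → S t ≡ true → s ≢ t → v ~ s → v ~ t → NonSimplicial t →
      ∃ λ c → c ~ s × c ~ t × c # v
    exchange {s} {t} {v} Ss St s≢t v~s v~t t-nonsimp
      -- Choosing `e` to miss `v` ensures that `c`, being close to `e`, differs from `v`.
      with e , t~e , e#v ← escape t-nonsimp (~-sym v~t)
      with c , c≈t , c≈e , c≁T ← meet-edge (exchanged? s t v)
             (exchanged-stable Ss St s≢t v~s v~t) (inj₂ t~e)
      with c~t ← ~-sym (≈∧≢⇒~ (≈-sym c≈t) (~∧≁⇒≢ (~-sym v~t) (c≁T (inj₁ refl))))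
      -- `c` misses all of S outside s and t, so its second neighbour in S can only be `s`.
      with u , Su , c~u , u≢t ← second-neighbour St c~t
      with u ≟ s
    ... | yes refl = c , c~u , c~t , ≈∧#⇒≢ c≈e e#v , c≁T (inj₁ refl)
    ... | no u≢s = ⊥-elim (~⇒¬≁ c~u (c≁T (inj₂ (Su , u≢s , u≢t))))

  -- Let σ dominate `a` but miss the next vertex `b`, and let `z` be a member of S close to both a
  -- and b. If `z` is simplicial, it dominates `b`. Otherwise `exchange` on σ, a, z gives a
  -- neighbour of σ that misses `a`, although σ is simplicial.
  simplicials-dominate : Connected G → TrueTwinFree G → ∃ Simplicial →
    ∀ y → ∃ λ σ → Simplicial σ × σ ≈ y
  simplicials-dominate connected twinFree (σ₀ , σ₀-simp) y =
    reach-closed closed (connected σ₀ y) (σ₀ , σ₀-simp , inj₁ refl)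
    where
    S-extends : ∃ λ S → IsMaxStable G S × (∀ {x} → Simplicial x → S x ≡ true)
    S-extends = extend-stable simplicial? (simplicials-stable twinFree)

    closed : ∀ {a b} → (∃ λ σ → Simplicial σ × σ ≈ a) → a ~ b → ∃ λ σ → Simplicial σ × σ ≈ b
    closed {a} {b} (σ , σ-simp , σ≈a) a~b with ≈-or-# σ b | S-extends
    ... | inj₁ σ≈b | _ = σ , σ-simp , σ≈b
    ... | inj₂ σ#b | S , S-max , simp⊆S with meet-S S-max simp⊆S (inj₂ a~b)
    ... | z , z≈a , z≈b , Sz with nonSimplicial? z
    ... | no z-simp = z , z-simp , z≈b
    ... | yes z-nonsimp =
      let σ~a = ≈∧≢⇒~ σ≈a λ { refl → ≈⇒¬# (inj₂ a~b) σ#b }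
          a~z = ≈∧≢⇒~ (≈-sym z≈a) (~∧≁⇒≢ (~-sym σ~a) (stable S-max Sz (simp⊆S σ-simp)))
          c , c~σ , c~z , c#a = exchange S-max simp⊆S (simp⊆S σ-simp) Sz
            (λ σ≡z → ≈∧#⇒≢ z≈b (#-sym σ#b) (sym σ≡z)) (~-sym σ~a) a~z z-nonsimp
      in ⊥-elim (≈⇒¬# (simplicial-≈ σ-simp (~-sym c~σ) σ~a) c#a)

-- Line graphs

edge-≡ : ∀ {H} {e f : Edge H} → proj₁ e ≡ proj₁ f → e ≡ f
edge-≡ {e = _ , e< , e~} {_ , f< , f~} refl =
  cong (_ ,_) (cong₂ _,_ (ℕ.<-irrelevant e< f<) (Decidable⇒UIP.≡-irrelevant Bool._≟_ e~ f~))

Share : ∀ {H} → Edge H → Edge H → Set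
Share {H} e f = ∃ λ u → endpoint {H} e u × endpoint {H} f u

line-iso : ∀ {G H} (f : Fin (n G) → Edge H) → Injective _≡_ _≡_ f → (∀ e → ∃ λ v → f v ≡ e) →
  (∀ {v w} → adj G v w ≡ true → Share {H} (f v) (f w)) →
  (∀ {v w} → v ≢ w → Share {H} (f v) (f w) → adj G v w ≡ true) → G ≅L H
line-iso {G} f f-inj f-onto share shared = record
  { iso = bijection f f-inj f-onto
  ; preserve = λ v w → (λ v~w → (Adjacency.~⇒≢ G v~w ∘ f-inj) , share v~w) ,
                       (λ (fv≢fw , s) → shared (fv≢fw ∘ cong f) s) }

-- Edges are stored as increasing pairs; this puts the left-block end of an edge between the two
-- blocks first.
↑ˡ<↑ʳ : ∀ {k l} (i : Fin k) (j : Fin l) → i ↑ˡ l Fin.< k ↑ʳ j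
↑ˡ<↑ʳ {k} {l} i j rewrite Fin.toℕ-↑ˡ i l | Fin.toℕ-↑ʳ k j =
  ℕ.<-≤-trans (Fin.toℕ<n i) (ℕ.m≤m+n k (toℕ j))

↑ˡ≢↑ʳ : ∀ {k l} (i : Fin k) (j : Fin l) → i ↑ˡ l ≢ k ↑ʳ j
↑ˡ≢↑ʳ i j eq = ℕ.<-irrefl (cong toℕ eq) (↑ˡ<↑ʳ i j)

-- L(K_{k,l}) as the k × l rook graph

record Rook (G : Graph) (k l : ℕ) : Set where
  open Adjacency G
  field
    row : V → Fin k
    col : V → Fin l
    unique : ∀ {v w} → row v ≡ row w → col v ≡ col w → v ≡ w
    square : ∀ i j → ∃ λ v → row v ≡ i × col v ≡ j
    line : ∀ {v w} → v ~ w → row v ≡ row w ⊎ col v ≡ col w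
    attack : ∀ {v w} → v ≢ w → row v ≡ row w ⊎ col v ≡ col w → v ~ w

transpose : ∀ {G k l} → Rook G k l → Rook G l k
transpose R = record
  { row = col ; col = row ; unique = λ p q → unique q p
  ; square = λ i j → let v , p , q = square j i in v , q , p
  ; line = [ inj₂ , inj₁ ]′ ∘ line ; attack = λ v≢w → attack v≢w ∘ [ inj₂ , inj₁ ]′ }
  where open Rook R

cell : ∀ {k} → Fin k → Fin k → Edge (Kbip k)
cell {k} i j = (i ↑ˡ k , k ↑ʳ j) , ↑ˡ<↑ʳ i j , adjacent
  where
  adjacent : bipAdj (splitAt k (i ↑ˡ k)) (splitAt k (k ↑ʳ j)) ≡ true
  adjacent rewrite Fin.splitAt-↑ˡ k i k | Fin.splitAt-↑ʳ k k j = refl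

cell-injective : ∀ {k} {i j i' j' : Fin k} → cell i j ≡ cell i' j' → i ≡ i' × j ≡ j'
cell-injective {k} eq =
  Fin.↑ˡ-injective k _ _ (cong (proj₁ ∘ proj₁) eq) , Fin.↑ʳ-injective k _ _ (cong (proj₂ ∘ proj₁) eq)

cell-onto : ∀ {k} (e : Edge (Kbip k)) → ∃₂ λ i j → cell i j ≡ e
cell-onto {k} e@((a , b) , a<b , a~b) = let i , j , eq = ends a b a<b a~b in i , j , edge-≡ {Kbip k} eq
  where
  ends : ∀ a b → a Fin.< b → adj (Kbip k) a b ≡ true → ∃₂ λ i j → (i ↑ˡ k , k ↑ʳ j) ≡ (a , b)
  ends a b a<b a~b with splitAt k a in eqa | splitAt k b in eqb
  ... | inj₁ i | inj₂ j = i , j , cong₂ _,_ (Fin.splitAt⁻¹-↑ˡ eqa) (Fin.splitAt⁻¹-↑ʳ {k} eqb)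
  -- A pair starting in the right block and ending in the left one is decreasing, so it stores no
  -- edge.
  ... | inj₂ i | inj₁ j with refl ← Fin.splitAt⁻¹-↑ʳ {k} eqa | refl ← Fin.splitAt⁻¹-↑ˡ eqb =
        contradiction a<b (ℕ.<-asym (↑ˡ<↑ʳ j i))

cell-share⇒ : ∀ {k} {i j i' j' : Fin k} → Share {Kbip k} (cell i j) (cell i' j') → i ≡ i' ⊎ j ≡ j'
cell-share⇒ {k} (_ , inj₁ refl , inj₁ eq) = inj₁ (Fin.↑ˡ-injective k _ _ eq)
cell-share⇒ {k} (_ , inj₁ refl , inj₂ eq) = contradiction eq (↑ˡ≢↑ʳ _ _)
cell-share⇒ {k} (_ , inj₂ refl , inj₁ eq) = contradiction (sym eq) (↑ˡ≢↑ʳ _ _)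
cell-share⇒ {k} (_ , inj₂ refl , inj₂ eq) = inj₂ (Fin.↑ʳ-injective k _ _ eq)

cell-share⇐ : ∀ {k} {i j i' j' : Fin k} → i ≡ i' ⊎ j ≡ j' → Share {Kbip k} (cell i j) (cell i' j')
cell-share⇐ (inj₁ refl) = _ , inj₁ refl , inj₁ refl
cell-share⇐ (inj₂ refl) = _ , inj₂ refl , inj₂ refl

rook⇒≅L : ∀ {G k} → Rook G k k → G ≅L Kbip k
rook⇒≅L {G} {k} R = line-iso (λ v → cell (row v) (col v))
  (λ eq → let p , q = cell-injective eq in unique p q)
  onto (cell-share⇐ ∘ line) (λ v≢w → attack v≢w ∘ cell-share⇒)
  where
  open Rook R
  onto : ∀ e → ∃ λ v → cell (row v) (col v) ≡ e
  onto e = let i , j , eq = cell-onto e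
               v , p , q = square i j
           in v , trans (cong₂ cell p q) eq

≅L⇒rook : ∀ {G k} → G ≅L Kbip k → Rook G k k
≅L⇒rook {G} {k} G≅L = record
  { row = row ; col = col
  ; unique = λ {v} {w} p q → Injection.injective (↔⇒↣ iso)
      (trans (sym (cell-to v)) (trans (cong₂ cell p q) (cell-to w)))
  ; square = λ i j → let eq = trans (cell-to _) (Inverse.strictlyInverseˡ iso (cell i j))
                     in Inverse.from iso (cell i j) , cell-injective eq
  ; line = λ {v} {w} v~w → cell-share⇒
      (subst₂ (Share {Kbip k}) (sym (cell-to v)) (sym (cell-to w)) (proj₂ (proj₁ (preserve v w) v~w)))
  ; attack = λ {v} {w} v≢w p → proj₂ (preserve v w)
      (v≢w ∘ Injection.injective (↔⇒↣ iso) ,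
       subst₂ (Share {Kbip k}) (cell-to v) (cell-to w) (cell-share⇐ p)) }
  where
  open _≅L_ G≅L
  row col : Fin (n G) → Fin k
  row v = proj₁ (cell-onto (Inverse.to iso v))
  col v = proj₁ (proj₂ (cell-onto (Inverse.to iso v)))
  cell-to : ∀ v → cell (row v) (col v) ≡ Inverse.to iso v
  cell-to v = proj₂ (proj₂ (cell-onto (Inverse.to iso v)))

-- Square rook graphs are CIS

injection-hits : ∀ {k} {f : Fin k → Fin k} → Injective _≡_ _≡_ f → ∀ i → ¬ (∀ j → i ≢ f j)
injection-hits {suc k} {f} f-inj i i∉f = ℕ.1+n≰n
  -- If `i` were missed, `punchOut` would inject `Fin (suc k)` into `Fin k`.
  (Fin.injective⇒≤ {f = λ j → punchOut (i∉f j)}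
    λ {x} {y} eq → f-inj (Fin.punchOut-injective (i∉f x) (i∉f y) eq))

module _ {G : Graph} {k : ℕ} where
  open Adjacency G

  -- Suppose S misses row `i`. Then it meets every column `j`, since the square (i, j) could
  -- otherwise be added. Representatives of distinct columns lie in distinct rows, so the k columns
  -- use all k rows, including row `i`.
  maxStable-meets-row : (R : Rook G k k) (let open Rook R) → ∀ {S} → IsMaxStable G S →
    ∀ i → ∃ λ s → S s ≡ true × row s ≡ i
  maxStable-meets-row R {S} S-max i with any? (λ s → (S s Bool.≟ true) ×-dec (Rook.row R s ≟ i))
  ... | yes s = s
  ... | no ¬row-i = ⊥-elim (injection-hits f-inj i λ j i≡fj → ¬row-i (_ , S-rep j , sym i≡fj))
    where
    open Rook R
    hit : ∀ j → ∃ λ s → S s ≡ true × col s ≡ j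
    hit j with any? (λ s → (S s Bool.≟ true) ×-dec (col s ≟ j))
    ... | yes s = s
    ... | no ¬col-j with v , refl , refl ← square i j =
      contradiction (v , maxStable-absorbs S-max v≁S , refl) ¬col-j
      where
      v≁S : ∀ {t} → S t ≡ true → v ≁ t
      v≁S St = ¬~⇒≁ λ v~t → [ (λ p → ¬row-i (_ , St , sym p)) , (λ p → ¬col-j (_ , St , sym p)) ]′ (line v~t)
    rep : Fin k → V
    rep j = proj₁ (hit j)
    S-rep : ∀ j → S (rep j) ≡ true
    S-rep j = proj₁ (proj₂ (hit j))
    f-inj : Injective _≡_ _≡_ (row ∘ rep)
    f-inj {j} {j'} eq with rep j ≟ rep j'
    ... | yes p = trans (sym (proj₂ (proj₂ (hit j)))) (trans (cong col p) (proj₂ (proj₂ (hit j'))))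
    ... | no p = ⊥-elim (~⇒¬≁ (attack p (inj₁ eq)) (stable S-max (S-rep j) (S-rep j')))

  row-in-maxClique : (R : Rook G k k) (let open Rook R) → ∀ {C c} → IsMaxClique G C →
    (∀ {v} → C v ≡ true → row v ≡ row c) → ∀ {v} → row v ≡ row c → C v ≡ true
  row-in-maxClique R {C} {c} C-max C-row {v} p = maxClique-absorbs C-max λ {t} Ct →
    ¬#⇒≈ λ (v≢t , v≁t) → ~⇒¬≁ (Rook.attack R v≢t (inj₁ (trans p (sym (C-row Ct))))) v≁t

  -- A maximal clique is a full row or a full column. If some `d` in C leaves the row of `c`, then c
  -- and d share a column, and every member of C lies outside the row of one of them, hence in that
  -- column.
  rook-cis : 1 ≤ n G → Rook G k k → CIS G
  rook-cis 1≤n R C S C-max S-max with any? (λ c → C c Bool.≟ true)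
  ... | no ¬C = contradiction
          (fromℕ< 1≤n , maxClique-absorbs C-max (λ Ct → contradiction (_ , Ct) ¬C)) ¬C
  ... | yes (c , Cc) with any? (λ d → (C d Bool.≟ true) ×-dec ¬? (Rook.row R d ≟ Rook.row R c))
  ... | no ¬d =
    let s , Ss , p = maxStable-meets-row R S-max (Rook.row R c)
    in s , row-in-maxClique R C-max C-row p , Ss
    where
    C-row : ∀ {v} → C v ≡ true → Rook.row R v ≡ Rook.row R c
    C-row {v} Cv with Rook.row R v ≟ Rook.row R c
    ... | yes p = p
    ... | no p = contradiction (v , Cv , p) ¬d
  ... | yes (d , Cd , row-d≢row-c) =
    let s , Ss , p = maxStable-meets-row (transpose R) S-max (col c)
    in s , row-in-maxClique (transpose R) C-max C-col p , Ss
    where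
    open Rook R
    common : ∀ {v w} → C v ≡ true → C w ≡ true → row v ≢ row w → col v ≡ col w
    common Cv Cw p with clique C-max Cv Cw
    ... | inj₁ refl = refl
    ... | inj₂ v~w = [ (λ q → contradiction q p) , id ]′ (line v~w)
    C-col : ∀ {v} → C v ≡ true → col v ≡ col c
    C-col {v} Cv with row v ≟ row c
    ... | no p = common Cv Cc p
    ... | yes p = trans (common Cv Cd λ q → row-d≢row-c (trans (sym q) p)) (common Cd Cc row-d≢row-c)


-- If k < l then the diagonal of a k × l board is a maximal stable set that misses the column
-- with index k.
rook-cis⇒≮ : ∀ {G k l} → ClawFree G → CIS G → Rook G k l → 2 ≤ k → ¬ (k ℕ.< l)
rook-cis⇒≮ {G} {k} {l} clawFree cis R 2≤k k<l =
  let z , z≈K , z≁T = ClawFreeCIS.meet G clawFree cis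
        (λ v → col v ≟ fromℕ< k<l) (λ v → toℕ (row v) ℕ.≟ toℕ (col v)) column diagonal
      -- As k < l, the diagonal has a cell in every row; `z` is not attacked by the one in its own
      -- row and therefore equals it.
      t , t-row , t-col = square (row z) (Fin.inject≤ (row z) (ℕ.<⇒≤ k<l))
      on-diagonal = trans (cong toℕ t-row) (sym (trans (cong toℕ t-col) (Fin.toℕ-inject≤ (row z) _)))
      z≡t = unattacked (z≁T on-diagonal) (sym t-row)
      -- A second row is where `2 ≤ k` enters. The cell of column k in that row shares no line with
      -- `z`, whose column index is below k.
      i , i≢row-z = other 2≤k (row z)
      v , v-row , v-col = square i (fromℕ< k<l)
      z-col<k = subst (ℕ._< k) (sym (trans (cong (toℕ ∘ col) z≡t)
                  (trans (cong toℕ t-col) (Fin.toℕ-inject≤ (row z) _)))) (Fin.toℕ<n (row z))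
      z-col≢v-col = λ (eq : col z ≡ col v) → ℕ.<-irrefl
                  (trans (cong toℕ (trans eq v-col)) (Fin.toℕ-fromℕ< k<l)) z-col<k
  in [ (λ z≡v → z-col≢v-col (cong col z≡v)) ,
       (λ z~v → [ (λ eq → i≢row-z (trans (sym v-row) (sym eq))) , z-col≢v-col ]′ (line z~v)) ]′ (z≈K v-col)
  where
  open Adjacency G
  open Rook R

  unattacked : ∀ {v w} → v ≁ w → row v ≡ row w → v ≡ w
  unattacked {v} {w} v≁w p with v ≟ w
  ... | yes v≡w = v≡w
  ... | no v≢w = ⊥-elim (~⇒¬≁ (attack v≢w (inj₁ p)) v≁w)

  column : ∀ {v w} → col v ≡ fromℕ< k<l → col w ≡ fromℕ< k<l → v ≈ w
  column p q = ¬#⇒≈ λ (v≢w , v≁w) → ~⇒¬≁ (attack v≢w (inj₂ (trans p (sym q)))) v≁w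

  diagonal : ∀ {v w} → toℕ (row v) ≡ toℕ (col v) → toℕ (row w) ≡ toℕ (col w) → v ≁ w
  diagonal p q = ¬~⇒≁ λ v~w → ~⇒≢ v~w
    ([ (λ e → unique e (Fin.toℕ-injective (trans (sym p) (trans (cong toℕ e) q)))) ,
       (λ e → unique (Fin.toℕ-injective (trans p (trans (cong toℕ e) (sym q)))) e) ]′ (line v~w))

  other : ∀ {m} → 2 ≤ m → (i : Fin m) → ∃ λ j → j ≢ i
  other (s≤s (s≤s _)) zero = suc zero , λ ()
  other (s≤s (s≤s _)) (suc i) = zero , λ ()

rook-cis⇒square : ∀ {G k l} → ClawFree G → CIS G → Rook G k l → 2 ≤ k → 2 ≤ l → k ≡ l
rook-cis⇒square {k = k} {l} clawFree cis R 2≤k 2≤l with ℕ.<-cmp k l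
... | tri< k<l _ _ = contradiction k<l (rook-cis⇒≮ clawFree cis R 2≤k)
... | tri≈ _ k≡l _ = k≡l
... | tri> _ _ l<k = contradiction l<k (rook-cis⇒≮ clawFree cis (transpose R) 2≤l)

-- L(G' ∘ K₁) as the line graph of G' with a loop at every vertex: the pendant edge at a becomes the
-- loop (a , a).

module _ (G' : Graph) where
  private
    k : ℕ
    k = n G'

  LoopOrEdge : Fin k → Fin k → Set
  LoopOrEdge a b = a ≡ b ⊎ (a Fin.< b × adj G' a b ≡ true)

  record LoopedLine (G : Graph) : Set where
    open Adjacency G
    field
      left right : V → Fin k
      valid : ∀ v → LoopOrEdge (left v) (right v)
      unique : ∀ {v w} → left v ≡ left w → right v ≡ right w → v ≡ w
      vertex : ∀ {a b} → LoopOrEdge a b → ∃ λ v → left v ≡ a × right v ≡ b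

    End : V → Fin k → Set
    End v a = a ≡ left v ⊎ a ≡ right v

    field
      meeting : ∀ {v w} → v ~ w → ∃ λ a → End v a × End w a
      adjacent : ∀ {v w a} → v ≢ w → End v a → End w a → v ~ w

  corona-edge : ∀ a b → LoopOrEdge a b → Edge (corona G')
  corona-edge a b (inj₁ _) = (a ↑ˡ k , k ↑ʳ a) , ↑ˡ<↑ʳ a a , pendant
    where
    pendant : adj (corona G') (a ↑ˡ k) (k ↑ʳ a) ≡ true
    pendant rewrite Fin.splitAt-↑ˡ k a k | Fin.splitAt-↑ʳ k k a = eqb-refl a
  corona-edge a b (inj₂ (a<b , a~b)) = (a ↑ˡ k , b ↑ˡ k) , ↑ˡ-mono , inner
    where
    ↑ˡ-mono : a ↑ˡ k Fin.< b ↑ˡ k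
    ↑ˡ-mono rewrite Fin.toℕ-↑ˡ a k | Fin.toℕ-↑ˡ b k = a<b
    inner : adj (corona G') (a ↑ˡ k) (b ↑ˡ k) ≡ true
    inner rewrite Fin.splitAt-↑ˡ k a k | Fin.splitAt-↑ˡ k b k = a~b

  -- Sends a vertex of G' and its pendant copy to the same index, so that a common endpoint in the
  -- corona becomes a common end in the looped graph.
  base : Fin (k + k) → Fin k
  base u = [ id , id ]′ (splitAt k u)

  base-↑ˡ : ∀ a → base (a ↑ˡ k) ≡ a
  base-↑ˡ a rewrite Fin.splitAt-↑ˡ k a k = refl

  base-↑ʳ : ∀ a → base (k ↑ʳ a) ≡ a
  base-↑ʳ a rewrite Fin.splitAt-↑ʳ k k a = refl

  base-left : ∀ {a b} val → base (proj₁ (proj₁ (corona-edge a b val))) ≡ a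
  base-left (inj₁ _) = base-↑ˡ _
  base-left (inj₂ _) = base-↑ˡ _

  base-right : ∀ {a b} val → base (proj₂ (proj₁ (corona-edge a b val))) ≡ b
  base-right (inj₁ refl) = base-↑ʳ _
  base-right (inj₂ _) = base-↑ˡ _

  corona-edge-cong : ∀ {a b c d} val val' → a ≡ c → b ≡ d → corona-edge a b val ≡ corona-edge c d val'
  corona-edge-cong (inj₁ _) (inj₁ _) refl refl = refl
  corona-edge-cong (inj₁ refl) (inj₂ (a<a , _)) refl refl = contradiction a<a (ℕ.<-irrefl refl)
  corona-edge-cong (inj₂ (a<a , _)) (inj₁ refl) refl refl = contradiction a<a (ℕ.<-irrefl refl)
  corona-edge-cong (inj₂ _) (inj₂ _) refl refl = edge-≡ {corona G'} refl

  corona-edge-injective : ∀ {a b c d} val val' → corona-edge a b val ≡ corona-edge c d val' → a ≡ c × b ≡ d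
  corona-edge-injective val val' eq =
    trans (sym (base-left val)) (trans (cong (base ∘ proj₁ ∘ proj₁) eq) (base-left val')) ,
    trans (sym (base-right val)) (trans (cong (base ∘ proj₂ ∘ proj₁) eq) (base-right val'))

  corona-edge-onto : ∀ e → ∃₂ λ a b → Σ (LoopOrEdge a b) λ val → corona-edge a b val ≡ e
  corona-edge-onto ((x , y) , x<y , x~y) =
    let a , b , val , eq = ends x y x<y x~y in a , b , val , edge-≡ {corona G'} eq
    where
    ends : ∀ x y → x Fin.< y → adj (corona G') x y ≡ true →
      ∃₂ λ a b → Σ (LoopOrEdge a b) λ val → proj₁ (corona-edge a b val) ≡ (x , y)
    ends x y x<y x~y with splitAt k x in eqx | splitAt k y in eqy
    ... | inj₁ a | inj₁ b with refl ← Fin.splitAt⁻¹-↑ˡ eqx | refl ← Fin.splitAt⁻¹-↑ˡ eqy =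
          a , b , inj₂ (subst₂ ℕ._<_ (Fin.toℕ-↑ˡ a k) (Fin.toℕ-↑ˡ b k) x<y , x~y) , refl
    ... | inj₁ a | inj₂ b with refl ← eqb⇒≡ {x = a} {b} x~y =
          a , a , inj₁ refl , cong₂ _,_ (Fin.splitAt⁻¹-↑ˡ eqx) (Fin.splitAt⁻¹-↑ʳ {k} eqy)
    ... | inj₂ a | inj₁ b with refl ← Fin.splitAt⁻¹-↑ʳ {k} eqx | refl ← Fin.splitAt⁻¹-↑ˡ eqy =
          contradiction x<y (ℕ.<-asym (↑ˡ<↑ʳ b a))

  endpoint⇒base : ∀ {a b} val {u} → endpoint {corona G'} (corona-edge a b val) u →
    base u ≡ a ⊎ base u ≡ b
  endpoint⇒base val (inj₁ refl) = inj₁ (base-left val)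
  endpoint⇒base val (inj₂ refl) = inj₂ (base-right val)

  -- The pendant edge at `c` contains `c` itself, so the unprimed copy witnesses the endpoint for
  -- both kinds of edge.
  base⇒endpoint : ∀ {a b} val {c} → c ≡ a ⊎ c ≡ b → endpoint {corona G'} (corona-edge a b val) (c ↑ˡ k)
  base⇒endpoint (inj₁ _) (inj₁ refl) = inj₁ refl
  base⇒endpoint (inj₁ refl) (inj₂ refl) = inj₁ refl
  base⇒endpoint (inj₂ _) (inj₁ refl) = inj₁ refl
  base⇒endpoint (inj₂ _) (inj₂ refl) = inj₂ refl

  module _ {G : Graph} where
    open Adjacency G

    loopedLine⇒≅L : LoopedLine G → G ≅L corona G'
    loopedLine⇒≅L L = line-iso (λ v → corona-edge (left v) (right v) (valid v))
      (λ {v} {w} eq → let p , q = corona-edge-injective (valid v) (valid w) eq in unique p q)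
      onto
      (λ {v} {w} v~w → let a , va , wa = meeting v~w in
         a ↑ˡ k , base⇒endpoint (valid v) va , base⇒endpoint (valid w) wa)
      (λ {v} {w} v≢w (u , vu , wu) →
         adjacent v≢w (endpoint⇒base (valid v) vu) (endpoint⇒base (valid w) wu))
      where
      open LoopedLine L
      onto : ∀ e → ∃ λ v → corona-edge (left v) (right v) (valid v) ≡ e
      onto e = let a , b , val , eq = corona-edge-onto e
                   v , p , q = vertex val
               in v , trans (corona-edge-cong (valid v) val p q) eq

    ≅L⇒loopedLine : G ≅L corona G' → LoopedLine G
    ≅L⇒loopedLine G≅L = record
      { left = left ; right = right ; valid = valid
      ; unique = λ {v} {w} p q → Injection.injective (↔⇒↣ iso) (trans (sym (edge-to v))
          (trans (corona-edge-cong (valid v) (valid w) p q) (edge-to w)))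
      ; vertex = λ {a} {b} val →
          let eq = trans (edge-to _) (Inverse.strictlyInverseˡ iso (corona-edge a b val))
          in Inverse.from iso (corona-edge a b val) , corona-edge-injective (valid _) val eq
      ; meeting = λ {v} {w} v~w →
          let u , vu , wu = proj₂ (proj₁ (preserve v w) v~w)
          in base u ,
             endpoint⇒base (valid v) (subst (λ e → endpoint {corona G'} e u) (sym (edge-to v)) vu) ,
             endpoint⇒base (valid w) (subst (λ e → endpoint {corona G'} e u) (sym (edge-to w)) wu)
      ; adjacent = λ {v} {w} {a} v≢w va wa → proj₂ (preserve v w)
          (v≢w ∘ Injection.injective (↔⇒↣ iso) , a ↑ˡ k ,
           subst (λ e → endpoint {corona G'} e (a ↑ˡ k)) (edge-to v) (base⇒endpoint (valid v) va) ,
           subst (λ e → endpoint {corona G'} e (a ↑ˡ k)) (edge-to w) (base⇒endpoint (valid w) wa)) }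
      where
      open _≅L_ G≅L
      left right : V → Fin k
      left v = proj₁ (corona-edge-onto (Inverse.to iso v))
      right v = proj₁ (proj₂ (corona-edge-onto (Inverse.to iso v)))
      valid : ∀ v → LoopOrEdge (left v) (right v)
      valid v = proj₁ (proj₂ (proj₂ (corona-edge-onto (Inverse.to iso v))))
      edge-to : ∀ v → corona-edge (left v) (right v) (valid v) ≡ Inverse.to iso v
      edge-to v = proj₂ (proj₂ (proj₂ (corona-edge-onto (Inverse.to iso v))))

    -- Line graphs of coronas of triangle-free graphs are CIS

    module _ (triangleFree : TriangleFree G') (L : LoopedLine G) where
      open LoopedLine L

      end? : ∀ v a → Dec (End v a)
      end? v a = (a ≟ left v) ⊎-dec (a ≟ right v)

      ends-adjacent : ∀ {v a b} → End v a → End v b → a ≢ b → adj G' a b ≡ true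
      ends-adjacent {v} (inj₁ refl) (inj₁ refl) a≢b = contradiction refl a≢b
      ends-adjacent {v} (inj₁ refl) (inj₂ refl) a≢b with valid v
      ... | inj₁ a≡b = contradiction a≡b a≢b
      ... | inj₂ (_ , a~b) = a~b
      ends-adjacent {v} (inj₂ refl) (inj₁ refl) a≢b with valid v
      ... | inj₁ b≡a = contradiction (sym b≡a) a≢b
      ... | inj₂ (_ , b~a) = Adjacency.~-sym G' b~a
      ends-adjacent {v} (inj₂ refl) (inj₂ refl) a≢b = contradiction refl a≢b

      ≈-meeting : ∀ {v w} → v ≈ w → ∃ λ a → End v a × End w a
      ≈-meeting {v} (inj₁ refl) = left v , inj₁ refl , inj₁ refl
      ≈-meeting (inj₂ v~w) = meeting v~w

      -- If neither end of `c` lies on all of C, take `v` avoiding the left end and `w` avoiding the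
      -- right end. They contain the opposite ends of `c` and meet in some `a`, which completes a
      -- triangle of G'.
      star-cover : ∀ {C c} → IsMaxClique G C → C c ≡ true → ∃ λ a → ∀ {v} → C v ≡ true → End v a
      star-cover {C} {c} C-max Cc
        with any? (λ v → (C v Bool.≟ true) ×-dec ¬? (end? v (left c)))
           | any? (λ v → (C v Bool.≟ true) ×-dec ¬? (end? v (right c)))
      ... | no ¬v | _ = left c , λ {v} Cv → decidable-stable (end? v _) λ ¬e → ¬v (v , Cv , ¬e)
      ... | yes _ | no ¬v = right c , λ {v} Cv → decidable-stable (end? v _) λ ¬e → ¬v (v , Cv , ¬e)
      ... | yes (v , Cv , v∌l) | yes (w , Cw , w∌r) with ≈-meeting (clique C-max Cv Cw)
      ... | a , va , wa = ⊥-elim (triangleFree (left c) (right c) a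
              (ends-adjacent (inj₁ refl) (inj₂ refl) λ l≡r → v∌l (subst (End v) (sym l≡r) v∋r))
              (ends-adjacent v∋r va λ r≡a → w∌r (subst (End w) (sym r≡a) wa))
              (ends-adjacent w∋l wa λ l≡a → v∌l (subst (End v) (sym l≡a) va)))
        where
        v∋r : End v (right c)
        v∋r with ≈-meeting (clique C-max Cv Cc)
        ... | _ , vb , inj₁ refl = contradiction vb v∌l
        ... | _ , vb , inj₂ refl = vb
        w∋l : End w (left c)
        w∋l with ≈-meeting (clique C-max Cw Cc)
        ... | _ , wb , inj₁ refl = wb
        ... | _ , wb , inj₂ refl = contradiction wb w∌r

      -- C lies in the star at some `a`. A member of S with end `a` meets all of C and so belongs to
      -- it. If there were none, the loop at `a`, which meets only vertices with end `a`, could be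
      -- added to S.
      loopedLine-cis : 1 ≤ n G → CIS G
      loopedLine-cis 1≤n C S C-max S-max with any? (λ c → C c Bool.≟ true)
      ... | no ¬C = contradiction
              (fromℕ< 1≤n , maxClique-absorbs C-max (λ Ct → contradiction (_ , Ct) ¬C)) ¬C
      ... | yes (c , Cc) with a , C-star ← star-cover C-max Cc
            with any? (λ s → (S s Bool.≟ true) ×-dec end? s a)
      ... | yes (s , Ss , sa) = s , maxClique-absorbs C-max s≈C , Ss
        where
        s≈C : ∀ {t} → C t ≡ true → s ≈ t
        s≈C Ct = ¬#⇒≈ λ (s≢t , s≁t) → ~⇒¬≁ (adjacent s≢t sa (C-star Ct)) s≁t
      ... | no ¬s with π , refl , π-right ← vertex (inj₁ (refl {x = a})) =
        contradiction (π , maxStable-absorbs S-max π≁S , inj₁ refl) ¬s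
        where
        π≁S : ∀ {t} → S t ≡ true → π ≁ t
        π≁S St = ¬~⇒≁ λ π~t → case meeting π~t of λ
          { (_ , inj₁ refl , ta) → ¬s (_ , St , ta)
          ; (_ , inj₂ eq , ta) → ¬s (_ , St , subst (End _) (trans eq π-right) ta) }

-- No simplicial vertices: the rook graph

two-elements : ∀ {k} {i j : Fin k} → i ≢ j → 2 ≤ k
two-elements {suc zero} {zero} {zero} i≢j = contradiction refl i≢j
two-elements {suc (suc k)} _ = s≤s (s≤s z≤n)

module RookCase (G : Graph) (clawFree : ClawFree G) (cis : CIS G)
  (¬diamond : ¬ ClawFreeCIS.Diamond G clawFree cis)
  (nonSimplicial : ∀ x → DiamondFreeCIS.NonSimplicial G clawFree cis ¬diamond x) where
  open Adjacency G
  open ClawFreeCIS G clawFree cis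
  open DiamondFreeCIS G clawFree cis ¬diamond

  -- With no simplicial vertices, any maximal stable set through s and t qualifies for `exchange`.
  fourth-vertex : ∀ {s t v} → s # t → v ~ s → v ~ t → ∃ λ c → c ~ s × c ~ t × c # v
  fourth-vertex {s} {t} s#t v~s v~t =
    let S , S-max , T⊆S = extend-stable (λ y → (y ≟ s) ⊎-dec (y ≟ t)) (pair-stable s#t)
    in exchange S-max (λ x-simp → contradiction (nonSimplicial _) x-simp)
         (T⊆S (inj₁ refl)) (T⊆S (inj₂ refl)) (proj₁ s#t) v~s v~t (nonSimplicial t)

  record Frame (x a b : V) : Set where
    field
      x~a : x ~ a
      x~b : x ~ b
      a#b : a # b

  -- The maximal clique through x and a, with x removed.
  Side : V → V → V → Set
  Side x a r = x ~ r × a ≈ r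

  flip : ∀ {x a b} → Frame x a b → Frame x b a
  flip F = record { x~a = x~b ; x~b = x~a ; a#b = #-sym a#b }
    where open Frame F

  module _ {x a b : V} (F : Frame x a b) where
    open Frame F

    not-both : ∀ {y} → x ~ y → y ≈ a → ¬ (y ≈ b)
    not-both x~y (inj₁ refl) a≈b = ≈⇒¬# a≈b a#b
    not-both x~y y≈a (inj₁ refl) = ≈⇒¬# (≈-sym y≈a) a#b
    not-both x~y (inj₂ y~a) (inj₂ y~b) = ≈⇒¬# (diamond-free x~y x~a x~b y~a y~b) a#b

    -- If r and q were equal or adjacent, diamond-freeness would bring q close to `a` as well as to
    -- `b`, against `not-both`.
    sides-# : ∀ {r q} → Side x a r → Side x b q → r # q
    sides-# {r} {q} (x~r , a≈r) (x~q , b≈q) with ≈-or-# r q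
    ... | inj₂ r#q = r#q
    ... | inj₁ r≈q = ⊥-elim (not-both x~q (q≈a a≈r r≈q) (≈-sym b≈q))
      where
      q≈a : a ≈ r → r ≈ q → q ≈ a
      q≈a (inj₁ refl) r≈q = ≈-sym r≈q
      q≈a (inj₂ a~r) (inj₁ refl) = inj₂ (~-sym a~r)
      q≈a (inj₂ a~r) (inj₂ r~q) = diamond-free x~r x~q x~a r~q (~-sym a~r)

    side : ∀ {y} → x ~ y → Side x a y ⊎ Side x b y
    side {y} x~y with ≈-or-# a y | ≈-or-# b y
    ... | inj₁ a≈y | _ = inj₁ (x~y , a≈y)
    ... | inj₂ _ | inj₁ b≈y = inj₂ (x~y , b≈y)
    ... | inj₂ a#y | inj₂ b#y = ⊥-elim (claw x~a x~b x~y a#b a#y b#y)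

    side-clique : ∀ {r r'} → Side x a r → Side x a r' → r ≈ r'
    side-clique (x~r , inj₁ refl) (_ , a≈r') = a≈r'
    side-clique (_ , a≈r) (_ , inj₁ refl) = ≈-sym a≈r
    side-clique (x~r , inj₂ a~r) (x~r' , inj₂ a~r') = diamond-free x~a x~r x~r' a~r a~r'

    -- The shadow of `z` on a side is its neighbour there. Two of them would be adjacent and form a
    -- diamond with x and z.
    shadow-unique : ∀ {z r r'} → z # x → Side x a r → Side x a r' → z ~ r → z ~ r' → r ≡ r'
    shadow-unique z#x r∈ r'∈ z~r z~r' with side-clique r∈ r'∈
    ... | inj₁ r≡r' = r≡r'
    ... | inj₂ r~r' = ⊥-elim (≈⇒¬# (diamond-free r~r' (~-sym z~r) (~-sym (proj₁ r∈))
                                     (~-sym z~r') (~-sym (proj₁ r'∈))) z#x)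

    -- The fourth vertex of the square over the path x r z is a neighbour of `x` that misses `r`, so
    -- it lies on the other side.
    other-shadow : ∀ {z r} → z # x → Side x a r → z ~ r → ∃ λ q → Side x b q × z ~ q
    other-shadow z#x r∈@(x~r , _) z~r =
      let c , c~x , c~z , c#r = fourth-vertex (#-sym z#x) (~-sym x~r) (~-sym z~r)
      in c , [ (λ c∈ → ⊥-elim (≈⇒¬# (side-clique c∈ r∈) c#r)) , id ]′ (side (~-sym c~x)) , ~-sym c~z

    corners-≈ : ∀ {r z z'} → x ~ r → z # x → z' # x → z ~ r → z' ~ r → z ≈ z'
    corners-≈ x~r z#x z'#x z~r z'~r = ¬#⇒≈ λ z#z' →
      claw (~-sym x~r) (~-sym z~r) (~-sym z'~r) (#-sym z#x) (#-sym z'#x) z#z'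

    -- Distinct corners z, z' over the same shadows are adjacent, by the claw at `r`, and would then
    -- form a diamond with r and q.
    corner-unique : ∀ {r q z z'} → Side x a r → Side x b q → z # x → z' # x →
      z ~ r → z ~ q → z' ~ r → z' ~ q → z ≡ z'
    corner-unique r∈ q∈ z#x z'#x z~r z~q z'~r z'~q with corners-≈ (proj₁ r∈) z#x z'#x z~r z'~r
    ... | inj₁ z≡z' = z≡z'
    ... | inj₂ z~z' = ⊥-elim (≈⇒¬# (diamond-free z~z' z~r z~q z'~r z'~q) (sides-# r∈ q∈))

  -- Cell x a b v r q: the vertex v has coordinates r and q on the two maximal cliques through x.
  data Cell (x a b : V) : V → V → V → Set where
    origin : Cell x a b x x x
    onR : ∀ {r} → Side x a r → Cell x a b r r x
    onQ : ∀ {q} → Side x b q → Cell x a b q x q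
    off : ∀ {z r q} → Side x a r → Side x b q → z # x → z ~ r → z ~ q → Cell x a b z r q

  flip-cell : ∀ {x a b v r q} → Cell x a b v r q → Cell x b a v q r
  flip-cell origin = origin
  flip-cell (onR r∈) = onQ r∈
  flip-cell (onQ q∈) = onR q∈
  flip-cell (off r∈ q∈ z#x z~r z~q) = off q∈ r∈ z#x z~q z~r

  x∉side : ∀ {x a} {A : Set} → Side x a x → A
  x∉side (x~x , _) = contradiction refl (~⇒≢ x~x)

  near-not-off : ∀ {x v} {A : Set} → x ~ v → v # x → A
  near-not-off x~v v#x = ⊥-elim (≈⇒¬# (inj₂ (~-sym x~v)) v#x)

  cell-side : ∀ {x a b v r q} → Frame x a b → Cell x a b v r q → x ≈ r × a ≈ r
  cell-side F origin = inj₁ refl , inj₂ (~-sym (Frame.x~a F))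
  cell-side F (onR (x~r , a≈r)) = inj₂ x~r , a≈r
  cell-side F (onQ _) = inj₁ refl , inj₂ (~-sym (Frame.x~a F))
  cell-side F (off (x~r , a≈r) _ _ _ _) = inj₂ x~r , a≈r

  same-row : ∀ {x a b v w r q q'} → Frame x a b → Cell x a b v r q → Cell x a b w r q' → v ≈ w
  same-row F origin origin = inj₁ refl
  same-row F origin (onR r∈) = x∉side r∈
  same-row F origin (onQ (x~q , _)) = inj₂ x~q
  same-row F origin (off r∈ _ _ _ _) = x∉side r∈
  same-row F (onR r∈) origin = x∉side r∈
  same-row F (onR _) (onR _) = inj₁ refl
  same-row F (onR r∈) (onQ _) = x∉side r∈
  same-row F (onR _) (off _ _ _ z~r _) = inj₂ (~-sym z~r)
  same-row F (onQ (x~q , _)) origin = inj₂ (~-sym x~q)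
  same-row F (onQ _) (onR r∈) = x∉side r∈
  same-row F (onQ q∈) (onQ q'∈) = side-clique (flip F) q∈ q'∈
  same-row F (onQ _) (off r∈ _ _ _ _) = x∉side r∈
  same-row F (off r∈ _ _ _ _) origin = x∉side r∈
  same-row F (off _ _ _ z~r _) (onR _) = inj₂ z~r
  same-row F (off r∈ _ _ _ _) (onQ _) = x∉side r∈
  same-row F (off (x~r , _) _ z#x z~r _) (off _ _ z'#x z'~r _) = corners-≈ F x~r z#x z'#x z~r z'~r

  cell-unique : ∀ {x a b v w r q} → Frame x a b → Cell x a b v r q → Cell x a b w r q → v ≡ w
  cell-unique F origin origin = refl
  cell-unique F origin (onR r∈) = x∉side r∈
  cell-unique F origin (onQ q∈) = x∉side q∈
  cell-unique F origin (off r∈ _ _ _ _) = x∉side r∈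
  cell-unique F (onR r∈) origin = x∉side r∈
  cell-unique F (onR _) (onR _) = refl
  cell-unique F (onR r∈) (onQ _) = x∉side r∈
  cell-unique F (onR _) (off _ q∈ _ _ _) = x∉side q∈
  cell-unique F (onQ q∈) origin = x∉side q∈
  cell-unique F (onQ _) (onR r∈) = x∉side r∈
  cell-unique F (onQ _) (onQ _) = refl
  cell-unique F (onQ _) (off r∈ _ _ _ _) = x∉side r∈
  cell-unique F (off r∈ _ _ _ _) origin = x∉side r∈
  cell-unique F (off _ q∈ _ _ _) (onR _) = x∉side q∈
  cell-unique F (off r∈ _ _ _ _) (onQ _) = x∉side r∈
  cell-unique F (off r∈ q∈ z#x z~r z~q) (off _ _ z'#x z'~r z'~q) =
    corner-unique F r∈ q∈ z#x z'#x z~r z~q z'~r z'~q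

  row-unique : ∀ {x a b v r q r' q'} → Frame x a b → Cell x a b v r q → Cell x a b v r' q' → r ≡ r'
  row-unique F origin origin = refl
  row-unique F origin (onR _) = refl
  row-unique F origin (onQ _) = refl
  row-unique F origin (off _ _ x#x _ _) = contradiction refl (proj₁ x#x)
  row-unique F (onR _) origin = refl
  row-unique F (onR _) (onR _) = refl
  row-unique F (onR r∈) (onQ r∈') = contradiction refl (proj₁ (sides-# F r∈ r∈'))
  row-unique F (onR (x~r , _)) (off _ _ r#x _ _) = near-not-off x~r r#x
  row-unique F (onQ _) origin = refl
  row-unique F (onQ q∈) (onR q∈') = contradiction refl (proj₁ (sides-# F q∈' q∈))
  row-unique F (onQ _) (onQ _) = refl
  row-unique F (onQ (x~q , _)) (off _ _ q#x _ _) = near-not-off x~q q#x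
  row-unique F (off _ _ x#x _ _) origin = contradiction refl (proj₁ x#x)
  row-unique F (off _ _ r#x _ _) (onR (x~r , _)) = near-not-off x~r r#x
  row-unique F (off _ _ q#x _ _) (onQ (x~q , _)) = near-not-off x~q q#x
  row-unique F (off r∈ _ z#x z~r _) (off r'∈ _ _ z~r' _) = shadow-unique F z#x r∈ r'∈ z~r z~r'

  cell-line : ∀ {x a b v w r q r' q'} → Frame x a b → Cell x a b v r q → Cell x a b w r' q' →
    v ~ w → r ≡ r' ⊎ q ≡ q'
  cell-line F origin origin _ = inj₁ refl
  cell-line F origin (onR _) _ = inj₂ refl
  cell-line F origin (onQ _) _ = inj₁ refl
  cell-line F origin (off _ _ z#x _ _) x~z = near-not-off x~z z#x
  cell-line F (onR _) origin _ = inj₂ refl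
  cell-line F (onR _) (onR _) _ = inj₂ refl
  cell-line F (onR r∈) (onQ q∈) r~q = ⊥-elim (≈⇒¬# (inj₂ r~q) (sides-# F r∈ q∈))
  cell-line F (onR r∈) (off r'∈ _ z#x z~r' _) r~z =
    inj₁ (shadow-unique F z#x r∈ r'∈ (~-sym r~z) z~r')
  cell-line F (onQ _) origin _ = inj₁ refl
  cell-line F (onQ q∈) (onR r∈) q~r = ⊥-elim (≈⇒¬# (inj₂ (~-sym q~r)) (sides-# F r∈ q∈))
  cell-line F (onQ _) (onQ _) _ = inj₁ refl
  cell-line F (onQ q∈) (off _ q'∈ z#x _ z~q') q~z =
    inj₂ (shadow-unique (flip F) z#x q∈ q'∈ (~-sym q~z) z~q')
  cell-line F (off _ _ z#x _ _) origin z~x = near-not-off (~-sym z~x) z#x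
  cell-line F (off r'∈ _ z#x z~r' _) (onR r∈) z~r = inj₁ (shadow-unique F z#x r'∈ r∈ z~r' z~r)
  cell-line F (off _ q'∈ z#x _ z~q') (onQ q∈) z~q = inj₂ (shadow-unique (flip F) z#x q'∈ q∈ z~q' z~q)
  -- For two vertices outside N[x], `w` must see r or q, since r, q, w would otherwise be a claw at
  -- `v`. By uniqueness of shadows the one it sees is its own coordinate.
  cell-line {w = w} {r} {q} F (off r∈@(x~r , _) q∈@(x~q , _) z#x z~r z~q)
                              (off r'∈ q'∈ w#x w~r' w~q') z~w
    with ≈-or-# r w | ≈-or-# q w
  ... | inj₁ (inj₁ refl) | _ = near-not-off x~r w#x
  ... | inj₁ (inj₂ r~w) | _ = inj₁ (shadow-unique F w#x r∈ r'∈ (~-sym r~w) w~r')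
  ... | inj₂ _ | inj₁ (inj₁ refl) = near-not-off x~q w#x
  ... | inj₂ _ | inj₁ (inj₂ q~w) = inj₂ (shadow-unique (flip F) w#x q∈ q'∈ (~-sym q~w) w~q')
  ... | inj₂ r#w | inj₂ q#w = ⊥-elim (claw z~r z~q z~w (sides-# F r∈ q∈) r#w q#w)

  cell-exists : ∀ {x a b r q} → Frame x a b → x ≈ r × a ≈ r → x ≈ q × b ≈ q → ∃ λ v → Cell x a b v r q
  cell-exists F (inj₁ refl , _) (inj₁ refl , _) = _ , origin
  cell-exists F (inj₂ x~r , a≈r) (inj₁ refl , _) = _ , onR (x~r , a≈r)
  cell-exists F (inj₁ refl , _) (inj₂ x~q , b≈q) = _ , onQ (x~q , b≈q)
  cell-exists F (inj₂ x~r , a≈r) (inj₂ x~q , b≈q) =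
    let z , z~r , z~q , z#x = fourth-vertex (sides-# F (x~r , a≈r) (x~q , b≈q)) x~r x~q
    in z , off (x~r , a≈r) (x~q , b≈q) z#x z~r z~q

  step-off : ∀ {x a b y z} → Frame x a b → x ~ y → y ~ z → z # x → ∃₂ (Cell x a b z)
  step-off F x~y y~z z#x with side F x~y
  ... | inj₁ y∈ = let q , q∈ , z~q = other-shadow F z#x y∈ (~-sym y~z)
                  in _ , _ , off y∈ q∈ z#x (~-sym y~z) z~q
  ... | inj₂ y∈ = let r , r∈ , z~r = other-shadow (flip F) z#x y∈ (~-sym y~z)
                  in _ , _ , off r∈ y∈ z#x z~r (~-sym y~z)

  -- No vertex is three steps from `x`: a neighbour `w` of a vertex `v` with shadows r and q equals
  -- or sees one of them, by the claw at `v`, and so acquires coordinates itself.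
  cells-closed : ∀ {x a b v w} → Frame x a b → ∃₂ (Cell x a b v) → v ~ w → ∃₂ (Cell x a b w)
  cells-closed {x} {w = w} F c v~w with ≈-or-# x w
  cells-closed F _ v~w | inj₁ (inj₁ refl) = _ , _ , origin
  cells-closed F _ v~w | inj₁ (inj₂ x~w) with side F x~w
  ... | inj₁ w∈ = _ , _ , onR w∈
  ... | inj₂ w∈ = _ , _ , onQ w∈
  cells-closed F (_ , _ , origin) x~w | inj₂ x#w = ⊥-elim (≈⇒¬# (inj₂ x~w) x#w)
  cells-closed F (_ , _ , onR (x~v , _)) v~w | inj₂ x#w = step-off F x~v v~w (#-sym x#w)
  cells-closed F (_ , _ , onQ (x~v , _)) v~w | inj₂ x#w = step-off F x~v v~w (#-sym x#w)
  cells-closed {w = w} F (r , q , off r∈@(x~r , _) q∈@(x~q , _) v#x v~r v~q) v~w | inj₂ x#w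
    with ≈-or-# r w | ≈-or-# q w
  ... | inj₁ (inj₁ refl) | _ = _ , _ , onR r∈
  ... | inj₁ (inj₂ r~w) | _ = step-off F x~r r~w (#-sym x#w)
  ... | inj₂ _ | inj₁ (inj₁ refl) = _ , _ , onQ q∈
  ... | inj₂ _ | inj₁ (inj₂ q~w) = step-off F x~q q~w (#-sym x#w)
  ... | inj₂ r#w | inj₂ q#w = ⊥-elim (claw v~r v~q v~w (sides-# F r∈ q∈) r#w q#w)

  record Enumeration (P : V → Set) (k : ℕ) : Set where
    field
      point : Fin k → V
      point-injective : Injective _≡_ _≡_ point
      sound : ∀ i → P (point i)
      complete : ∀ {y} → P y → ∃ λ i → point i ≡ y

    two-points : ∀ {y z} → P y → P z → y ≢ z → 2 ≤ k
    two-points Py Pz y≢z with i , refl ← complete Py | j , refl ← complete Pz =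
      two-elements (y≢z ∘ cong point)

  module _ (connected : Connected G) {x a b : V} (F : Frame x a b) {k l : ℕ}
    (R-enum : Enumeration (λ r → x ≈ r × a ≈ r) k) (Q-enum : Enumeration (λ q → x ≈ q × b ≈ q) l) where
    open Enumeration R-enum using () renaming
      (point to R; point-injective to R-injective; sound to R-sound; complete to R-complete)
    open Enumeration Q-enum using () renaming
      (point to Q; point-injective to Q-injective; sound to Q-sound; complete to Q-complete)

    coordinates : ∀ v → ∃₂ λ i j → Cell x a b v (R i) (Q j)
    coordinates v
      with r , q , c ← reach-closed (cells-closed F) (connected x v) (_ , _ , origin)
      with i , refl ← R-complete (cell-side F c) | j , refl ← Q-complete (cell-side (flip F) (flip-cell c))
      = i , j , c

    frame-rook : Rook G k l
    frame-rook = record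
      { row = row ; col = col ; unique = unique ; square = square ; line = line ; attack = attack }
      where
      row : V → Fin k
      row v = proj₁ (coordinates v)
      col : V → Fin l
      col v = proj₁ (proj₂ (coordinates v))
      at : ∀ v → Cell x a b v (R (row v)) (Q (col v))
      at v = proj₂ (proj₂ (coordinates v))

      at-row : ∀ {v w} → row v ≡ row w → Cell x a b w (R (row v)) (Q (col w))
      at-row {v} {w} p = subst (λ i → Cell x a b w (R i) (Q (col w))) (sym p) (at w)
      at-col : ∀ {v w} → col v ≡ col w → Cell x a b w (R (row w)) (Q (col v))
      at-col {v} {w} p = subst (λ j → Cell x a b w (R (row w)) (Q j)) (sym p) (at w)

      unique : ∀ {v w} → row v ≡ row w → col v ≡ col w → v ≡ w
      unique {v} {w} p q = cell-unique F (at v)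
        (subst (λ j → Cell x a b w (R (row v)) (Q j)) (sym q) (at-row p))

      square : ∀ i j → ∃ λ v → row v ≡ i × col v ≡ j
      square i j =
        let v , c = cell-exists F (R-sound i) (Q-sound j)
        in v , R-injective (row-unique F (at v) c) ,
           Q-injective (row-unique (flip F) (flip-cell (at v)) (flip-cell c))

      line : ∀ {v w} → v ~ w → row v ≡ row w ⊎ col v ≡ col w
      line {v} {w} v~w = [ inj₁ ∘ R-injective , inj₂ ∘ Q-injective ]′ (cell-line F (at v) (at w) v~w)

      attack : ∀ {v w} → v ≢ w → row v ≡ row w ⊎ col v ≡ col w → v ~ w
      attack {v} v≢w (inj₁ p) = ≈∧≢⇒~ (same-row F (at v) (at-row p)) v≢w
      attack {v} v≢w (inj₂ p) =
        ≈∧≢⇒~ (same-row (flip F) (flip-cell (at v)) (flip-cell (at-col p))) v≢w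

  enumeration : ∀ {P} → Decidable P → ∃ (Enumeration P)
  enumeration P? =
    let k , e , e-inj , e-sound , e-complete = enumerate P?
    in k , record { point = e ; point-injective = e-inj ; sound = e-sound ; complete = e-complete }

  rook : Connected G → V → ∃₂ λ k l → Rook G k l × 2 ≤ k × 2 ≤ l
  rook connected x =
    let a , b , x~a , x~b , a#b = nonSimplicial x
        k , R = enumeration (λ r → x ≈? r ×-dec a ≈? r)
        l , Q = enumeration (λ q → x ≈? q ×-dec b ≈? q)
    in k , l , frame-rook connected (record { x~a = x~a ; x~b = x~b ; a#b = a#b }) R Q ,
       Enumeration.two-points R (inj₂ x~a , inj₁ refl) (inj₁ refl , inj₂ (~-sym x~a)) (~⇒≢ (~-sym x~a)) ,
       Enumeration.two-points Q (inj₂ x~b , inj₁ refl) (inj₁ refl , inj₂ (~-sym x~b)) (~⇒≢ (~-sym x~b))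

  square-rook : Connected G → V → ∃ λ k → 1 ≤ k × Rook G k k
  square-rook connected x with k , l , R , 2≤k , 2≤l ← rook connected x
    with refl ← rook-cis⇒square clawFree cis R 2≤k 2≤l = k , ℕ.<⇒≤ 2≤k , R

-- Simplicial vertices: coronas

module CoronaCase (G : Graph) (clawFree : ClawFree G) (cis : CIS G)
  (¬diamond : ¬ ClawFreeCIS.Diamond G clawFree cis) (twinFree : TrueTwinFree G)
  (dominate : ∀ y → ∃ λ σ → DiamondFreeCIS.Simplicial G clawFree cis ¬diamond σ × Adjacency._≈_ G σ y)
  where
  open Adjacency G
  open ClawFreeCIS G clawFree cis
  open DiamondFreeCIS G clawFree cis ¬diamond

  -- The simplicial vertices form a stable set, so some `z` close to v and w misses all of them. As
  -- `z` is dominated by a simplicial vertex, it must be that vertex.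
  meet-simplicial : ∀ {v w} → v ≈ w → ∃ λ σ → Simplicial σ × v ≈ σ × w ≈ σ
  meet-simplicial v≈w =
    let z , z≈v , z≈w , z≁Σ = meet-edge simplicial? (simplicials-stable twinFree) v≈w
        σ , σ-simp , σ≈z = dominate z
        σ≡z = [ id , (λ σ~z → ⊥-elim (~⇒¬≁ (~-sym σ~z) (z≁Σ σ-simp))) ]′ σ≈z
    in σ , σ-simp , subst (_ ≈_) (sym σ≡z) (≈-sym z≈v) , subst (_ ≈_) (sym σ≡z) (≈-sym z≈w)

  module _ {k : ℕ} (s : Fin k → V) (s-injective : Injective _≡_ _≡_ s)
    (s-simplicial : ∀ a → Simplicial (s a)) (s-onto : ∀ {x} → Simplicial x → ∃ λ a → s a ≡ x) where

    s≁s : ∀ {a b} → s a ≁ s b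
    s≁s {a} {b} = simplicials-stable twinFree (s-simplicial a) (s-simplicial b)

    s#s : ∀ {a b} → a ≢ b → s a # s b
    s#s a≢b = a≢b ∘ s-injective , s≁s

    meet-s : ∀ {v w} → v ≈ w → ∃ λ a → v ≈ s a × w ≈ s a
    meet-s v≈w with meet-simplicial v≈w
    ... | σ , σ-simp , v≈σ , w≈σ with a , refl ← s-onto σ-simp = a , v≈σ , w≈σ

    star-clique : ∀ {a v w} → v ≈ s a → w ≈ s a → v ≈ w
    star-clique {a} v≈s w≈s = simplicial-closed-≈ (s-simplicial a) (≈-sym v≈s) (≈-sym w≈s)

    -- Two common neighbours of `s a` and `s b` are adjacent, both lying in the clique around `s a`,
    -- and would form a diamond.
    common-unique : ∀ {a b v w} → a ≢ b → v ~ s a → v ~ s b → w ~ s a → w ~ s b → v ≡ w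
    common-unique a≢b va vb wa wb with star-clique (inj₂ va) (inj₂ wa)
    ... | inj₁ v≡w = v≡w
    ... | inj₂ v~w = ⊥-elim (≈⇒¬# (diamond-free v~w va vb wa wb) (s#s a≢b))

    three-stars : ∀ {a b c v} → a ≢ b → a ≢ c → b ≢ c → v ~ s a → v ~ s b → v ~ s c → ⊥
    three-stars a≢b a≢c b≢c va vb vc = claw va vb vc (s#s a≢b) (s#s a≢c) (s#s b≢c)

    Linked : Fin k → Fin k → Set
    Linked a b = a ≢ b × ∃ λ v → v ~ s a × v ~ s b

    linked? : ∀ a b → Dec (Linked a b)
    linked? a b = ¬? (a ≟ b) ×-dec any? (λ v → v ~? s a ×-dec v ~? s b)

    linked-sym : ∀ {a b} → Linked a b → Linked b a
    linked-sym (a≢b , v , va , vb) = a≢b ∘ sym , v , vb , va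

    -- The graph G' of the corona: each index stands for the closed neighbourhood of a simplicial
    -- vertex, and two are joined when these cliques intersect.
    cliqueGraph : Graph
    cliqueGraph = record
      { n = k
      ; adj = λ a b → does (linked? a b)
      ; adj-sym = λ a b → does-⇔ (mk⇔ linked-sym linked-sym) (linked? a b) (linked? b a)
      ; adj-irrefl = λ a → dec-false (linked? a a) λ (a≢a , _) → a≢a refl }

    -- The vertices u, v, w linking the three pairs are pairwise adjacent and distinct, because no
    -- vertex lies in three stars. Then u and w are the centre of a diamond with tips `s a` and v.
    cliqueGraph-triangleFree : TriangleFree cliqueGraph
    cliqueGraph-triangleFree a b c ab bc ac
      with does-true⇒ (linked? a b) ab | does-true⇒ (linked? b c) bc | does-true⇒ (linked? a c) ac
    ... | a≢b , u , ua , ub | b≢c , v , vb , vc | a≢c , w , wa , wc =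
      ≈⇒¬# (diamond-free u~w ua u~v wa w~v)
           ((λ sa≡v → ~⇒¬≁ (subst (_~ s b) (sym sa≡v) vb) s≁s) ,
            ¬~⇒≁ λ sa~v → three-stars a≢b a≢c b≢c (~-sym sa~v) vb vc)
      where
      u~w : u ~ w
      u~w = ≈∧≢⇒~ (star-clique (inj₂ ua) (inj₂ wa))
        λ u≡w → three-stars a≢b a≢c b≢c ua ub (subst (_~ s c) (sym u≡w) wc)
      u~v : u ~ v
      u~v = ≈∧≢⇒~ (star-clique (inj₂ ub) (inj₂ vb))
        λ u≡v → three-stars a≢b a≢c b≢c ua ub (subst (_~ s c) (sym u≡v) vc)
      w~v : w ~ v
      w~v = ≈∧≢⇒~ (star-clique (inj₂ wc) (inj₂ vc))
        λ w≡v → three-stars a≢b a≢c b≢c wa (subst (_~ s b) (sym w≡v) vb) wc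

    nonSimplicial-~ : ∀ {v a} → NonSimplicial v → v ≈ s a → v ~ s a
    nonSimplicial-~ {a = a} v-nonsimp v≈a =
      ≈∧≢⇒~ v≈a λ v≡sa → s-simplicial a (subst NonSimplicial v≡sa v-nonsimp)

    Ends : V → Fin k → Fin k → Set
    Ends v a b = (a ≡ b × v ≡ s a) ⊎ (a Fin.< b × v ~ s a × v ~ s b)

    -- A simplicial vertex becomes a loop. Otherwise `v` has neighbours `x # y`; the stars covering
    -- the edges vx and vy are distinct, since a single star is a clique, and sorting their indices
    -- gives the edge.
    ends : ∀ v → ∃₂ (Ends v)
    ends v with nonSimplicial? v
    ... | no v-simp with a , refl ← s-onto v-simp = a , a , inj₁ (refl , refl)
    ... | yes v-nonsimp@(x , y , v~x , v~y , x#y) with meet-s (inj₂ v~x) | meet-s (inj₂ v~y)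
    ... | a , v≈a , x≈a | b , v≈b , y≈b with Fin.<-cmp a b
    ... | tri< a<b _ _ = a , b , inj₂ (a<b , nonSimplicial-~ v-nonsimp v≈a , nonSimplicial-~ v-nonsimp v≈b)
    ... | tri≈ _ refl _ = ⊥-elim (≈⇒¬# (star-clique x≈a y≈b) x#y)
    ... | tri> _ _ b<a = b , a , inj₂ (b<a , nonSimplicial-~ v-nonsimp v≈b , nonSimplicial-~ v-nonsimp v≈a)

    ends⇒≈ : ∀ {v a b c} → Ends v a b → c ≡ a ⊎ c ≡ b → v ≈ s c
    ends⇒≈ (inj₁ (refl , v≡sa)) (inj₁ refl) = inj₁ v≡sa
    ends⇒≈ (inj₁ (refl , v≡sa)) (inj₂ refl) = inj₁ v≡sa
    ends⇒≈ (inj₂ (_ , va , _)) (inj₁ refl) = inj₂ va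
    ends⇒≈ (inj₂ (_ , _ , vb)) (inj₂ refl) = inj₂ vb

    ≈⇒ends : ∀ {v a b c} → Ends v a b → v ≈ s c → c ≡ a ⊎ c ≡ b
    ≈⇒ends (inj₁ (_ , refl)) (inj₁ sa≡sc) = inj₁ (sym (s-injective sa≡sc))
    ≈⇒ends (inj₁ (_ , refl)) (inj₂ sa~sc) = ⊥-elim (~⇒¬≁ sa~sc s≁s)
    ≈⇒ends (inj₂ (_ , va , _)) (inj₁ refl) = ⊥-elim (~⇒¬≁ va s≁s)
    ≈⇒ends {a = a} {b} {c} (inj₂ (a<b , va , vb)) (inj₂ vc) with c ≟ a | c ≟ b
    ... | yes c≡a | _ = inj₁ c≡a
    ... | no _ | yes c≡b = inj₂ c≡b
    ... | no c≢a | no c≢b = ⊥-elim (three-stars (Fin.<⇒≢ a<b) (c≢a ∘ sym) (c≢b ∘ sym) va vb vc)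

    ends-unique : ∀ {v w a b} → Ends v a b → Ends w a b → v ≡ w
    ends-unique (inj₁ (_ , refl)) (inj₁ (_ , refl)) = refl
    ends-unique (inj₁ (refl , _)) (inj₂ (a<a , _)) = contradiction refl (Fin.<⇒≢ a<a)
    ends-unique (inj₂ (a<a , _)) (inj₁ (refl , _)) = contradiction refl (Fin.<⇒≢ a<a)
    ends-unique (inj₂ (a<b , va , vb)) (inj₂ (_ , wa , wb)) = common-unique (Fin.<⇒≢ a<b) va vb wa wb

    ends-functional : ∀ {v a b c d} → Ends v a b → Ends v c d → c ≡ a × d ≡ b
    ends-functional e f with ≈⇒ends e (ends⇒≈ f (inj₁ refl)) | ≈⇒ends e (ends⇒≈ f (inj₂ refl))
    ends-functional _ _ | inj₁ c≡a | inj₂ d≡b = c≡a , d≡b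
    ends-functional (inj₁ (refl , _)) _ | inj₁ c≡a | inj₁ d≡a = c≡a , d≡a
    ends-functional (inj₁ (refl , _)) _ | inj₂ c≡a | inj₁ d≡a = c≡a , d≡a
    ends-functional (inj₁ (refl , _)) _ | inj₂ c≡a | inj₂ d≡a = c≡a , d≡a
    ends-functional (inj₂ (_ , va , _)) (inj₁ (_ , refl)) | inj₁ _ | inj₁ _ = ⊥-elim (~⇒¬≁ va s≁s)
    ends-functional (inj₂ (_ , va , _)) (inj₁ (_ , refl)) | inj₂ _ | _ = ⊥-elim (~⇒¬≁ va s≁s)
    ends-functional (inj₂ _) (inj₂ (c<c , _)) | inj₁ refl | inj₁ refl = contradiction refl (Fin.<⇒≢ c<c)
    ends-functional (inj₂ _) (inj₂ (c<c , _)) | inj₂ refl | inj₂ refl = contradiction refl (Fin.<⇒≢ c<c)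
    ends-functional (inj₂ (a<b , _)) (inj₂ (b<a , _)) | inj₂ refl | inj₁ refl =
      contradiction b<a (ℕ.<-asym a<b)

    cliqueGraph-loopedLine : LoopedLine cliqueGraph G
    cliqueGraph-loopedLine = record
      { left = left ; right = right ; valid = valid
      ; unique = λ {v} {w} p q → ends-unique (at v) (subst₂ (Ends w) (sym p) (sym q) (at w))
      ; vertex = vertex
      ; meeting = λ {v} {w} v~w → let a , va , wa = meet-s (inj₂ v~w) in
          a , ≈⇒ends (at v) va , ≈⇒ends (at w) wa
      ; adjacent = λ {v} {w} v≢w va wa → ≈∧≢⇒~ (star-clique (ends⇒≈ (at v) va) (ends⇒≈ (at w) wa)) v≢w }
      where
      left right : V → Fin k
      left v = proj₁ (ends v)
      right v = proj₁ (proj₂ (ends v))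
      at : ∀ v → Ends v (left v) (right v)
      at v = proj₂ (proj₂ (ends v))

      valid : ∀ v → LoopOrEdge cliqueGraph (left v) (right v)
      valid v with at v
      ... | inj₁ (l≡r , _) = inj₁ l≡r
      ... | inj₂ (l<r , vl , vr) = inj₂ (l<r , dec-true (linked? _ _) (Fin.<⇒≢ l<r , v , vl , vr))

      vertex : ∀ {a b} → LoopOrEdge cliqueGraph a b → ∃ λ v → left v ≡ a × right v ≡ b
      vertex {a} (inj₁ refl) = s a , ends-functional (inj₁ (refl , refl)) (at (s a))
      vertex {a} {b} (inj₂ (a<b , ab)) = let _ , v , va , vb = does-true⇒ (linked? a b) ab in
        v , ends-functional (inj₂ (a<b , va , vb)) (at v)

  corona-line : V → ∃ λ G' → 1 ≤ n G' × TriangleFree G' × LoopedLine G' G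
  corona-line x with k , s , s-inj , s-simp , s-onto ← enumerate simplicial? =
    cliqueGraph s s-inj s-simp s-onto ,
    ℕ.≤-trans (s≤s z≤n) (Fin.toℕ<n (proj₁ (ends s s-inj s-simp s-onto x))) ,
    cliqueGraph-triangleFree s s-inj s-simp s-onto ,
    cliqueGraph-loopedLine s s-inj s-simp s-onto

-- The classification

theorem11 : (G : Graph) → 1 ≤ n G → Connected G → TrueTwinFree G → ClawFree G →
    CIS G ⇔ ((∃ λ p → ∃ λ q → (q ≤ 1) × (G ≅ complement ((p · K₂) ⊕ (q · K₁))))
    ⊎ (∃ λ k → (1 ≤ k) × (G ≅L Kbip k))
    ⊎ (∃ λ G' → (1 ≤ n G') × TriangleFree G' × (G ≅L corona G')))
theorem11 G 1≤n connected twinFree clawFree = mk⇔ classify converse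
  where
  Classification : Set
  Classification = (∃ λ p → ∃ λ q → (q ≤ 1) × (G ≅ complement ((p · K₂) ⊕ (q · K₁))))
    ⊎ (∃ λ k → (1 ≤ k) × (G ≅L Kbip k))
    ⊎ (∃ λ G' → (1 ≤ n G') × TriangleFree G' × (G ≅L corona G'))

  diamondFree-case : (cis : CIS G) → ¬ ClawFreeCIS.Diamond G clawFree cis → Classification
  diamondFree-case cis ¬diamond with any? (DiamondFreeCIS.simplicial? G clawFree cis ¬diamond)
  ... | yes ∃simplicial =
    let G' , 1≤n' , triangleFree , L = CoronaCase.corona-line G clawFree cis ¬diamond twinFree
          (DiamondFreeCIS.simplicials-dominate G clawFree cis ¬diamond connected twinFree ∃simplicial)
          (fromℕ< 1≤n)
    in inj₂ (inj₂ (G' , 1≤n' , triangleFree , loopedLine⇒≅L G' L))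
  ... | no ¬simplicial =
    let k , 1≤k , R = RookCase.square-rook G clawFree cis ¬diamond
          (λ x → decidable-stable (DiamondFreeCIS.nonSimplicial? G clawFree cis ¬diamond x)
                                  λ x-simp → ¬simplicial (x , x-simp))
          connected (fromℕ< 1≤n)
    in inj₂ (inj₁ (k , 1≤k , rook⇒≅L R))

  classify : CIS G → Classification
  classify cis with ClawFreeCIS.diamond? G clawFree cis
  ... | no ¬diamond = diamondFree-case cis ¬diamond
  ... | yes diamond =
    let _ , _ , _ , _ , _ , w = diamond⇒wheel twinFree diamond
        α≤2 = wheel⇒noStableTriple connected w
    in inj₁ (cocktail-iso G (non-neighbour-unique α≤2 twinFree) (universal-unique α≤2 twinFree))
    where open ClawFreeCIS G clawFree cis

  converse : Classification → CIS G
  converse (inj₁ (p , q , _ , G≅)) = cocktail-cis G p q G≅ 1≤n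
  converse (inj₂ (inj₁ (k , _ , G≅L))) = rook-cis 1≤n (≅L⇒rook G≅L)
  converse (inj₂ (inj₂ (G' , _ , triangleFree , G≅L))) =
    loopedLine-cis G' triangleFree (≅L⇒loopedLine G' G≅L) 1≤n
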